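{- Every GaTEx graph is weakly-chordal and hence perfect.
   Context: All graphs are finite, simple and undirected. A galled-tree on a finite nonempty set $X$ is a directed acyclic graph $N=(V,E)$ such that either $V=X=\{x\}$ and $E=\emptyset$, or: (N1) there is a unique root with indegree 0 and outdegree at least 2; (N2) $x\in X$ iff $x$ has outdegree 0 and indegree 1; (N3) every non-root $v\in V\setminus X$ has either indegree 1 and outdegree at least 2, or indegree 2 and outdegree at least 1 (hybrid-vertex); (N4) each biconnected component $C$ of $N$ contains at most one hybrid-vertex whose two in-neighbours both belong to $C$. For $x,y\in X$, $\mathrm{lca}_N(x,y)$ is the (unique) minimal common ancestor of $x,y$. A labeled galled-tree $(N,t)$ has $t:V\to\{0,1,\odot\}$ with $t(x)=\odot$ iff $x\in X$; it explains the graph on $X$ where $\{x,y\}$ is an edge iff $t(\mathrm{lca}_N(x,y))=1$. A graph is GaTEx if it is isomorphic to a graph explained by some labeled galled-tree. A hole is an induced cycle on at least five vertices, an anti-hole is the complement of a hole; a graph is weakly-chordal if it contains neither holes nor anti-holes as induced subgraphs. A graph is perfect if for every induced subgraph the chromatic number equals the clique number. -}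

module Defs where

open import Data.Nat using (ℕ; zero; suc; _+_; _≤_)
open import Data.Fin using (Fin; toℕ)
import Data.Fin as F
open import Data.Bool using (Bool; true; false; if_then_else_)
open import Data.Product using (Σ; ∃; ∃-syntax; _×_; _,_)
open import Data.Sum using (_⊎_)
open import Relation.Nullary using (¬_)
open import Relation.Binary.PropositionalEquality using (_≡_; _≢_)
open import Relation.Binary.Construct.Closure.ReflexiveTransitive using (Star)

infix 2 _⇔′_
_⇔′_ : Set → Set → Set
A ⇔′ B = (A → B) × (B → A)

Injective : ∀ {a b} → (Fin a → Fin b) → Set
Injective f = ∀ i j → f i ≡ f j → i ≡ j

count : ∀ {m} → (Fin m → Bool) → ℕ
count {zero}  p = 0
count {suc m} p = (if p F.zero then 1 else 0) + count (λ i → p (F.suc i))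

record Graph (n : ℕ) : Set where
  field
    adj    : Fin n → Fin n → Bool
    sym    : ∀ x y → adj x y ≡ adj y x
    irrefl : ∀ x → adj x x ≡ false

open Graph public

Edge : ∀ {n} → Graph n → Fin n → Fin n → Set
Edge G x y = adj G x y ≡ true

induced : ∀ {n m} → Graph n → (Fin m → Fin n) → Graph m
induced G f = record
  { adj    = λ i j → adj G (f i) (f j)
  ; sym    = λ i j → sym G (f i) (f j)
  ; irrefl = λ i → irrefl G (f i)
  }

CycSucc : ∀ k → Fin k → Fin k → Set
CycSucc k i j = (suc (toℕ i) ≡ toℕ j) ⊎ ((suc (toℕ i) ≡ k) × (toℕ j ≡ 0))

CycAdj : ∀ k → Fin k → Fin k → Set
CycAdj k i j = CycSucc k i j ⊎ CycSucc k j i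

IsHole : ∀ {n} → Graph n → (k : ℕ) → (Fin k → Fin n) → Set
IsHole G k f = 5 ≤ k × Injective f × (∀ i j → Edge G (f i) (f j) ⇔′ CycAdj k i j)

IsAntiHole : ∀ {n} → Graph n → (k : ℕ) → (Fin k → Fin n) → Set
IsAntiHole G k f = 5 ≤ k × Injective f ×
  (∀ i j → i ≢ j → Edge G (f i) (f j) ⇔′ (¬ CycAdj k i j))

WeaklyChordal : ∀ {n} → Graph n → Set
WeaklyChordal G =
  (∀ k (f : Fin k → Fin _) → ¬ IsHole G k f) ×
  (∀ k (f : Fin k → Fin _) → ¬ IsAntiHole G k f)

ProperColoring : ∀ {n} → Graph n → (k : ℕ) → (Fin n → Fin k) → Set
ProperColoring G k c = ∀ x y → Edge G x y → c x ≢ c y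

Colorable : ∀ {n} → Graph n → ℕ → Set
Colorable G k = Σ (Fin _ → Fin k) (ProperColoring G k)

IsChromaticNumber : ∀ {n} → Graph n → ℕ → Set
IsChromaticNumber G k = Colorable G k × (∀ j → Colorable G j → k ≤ j)

HasClique : ∀ {n} → Graph n → ℕ → Set
HasClique G k = Σ (Fin k → Fin _) λ g →
  Injective g × (∀ i j → i ≢ j → Edge G (g i) (g j))

IsCliqueNumber : ∀ {n} → Graph n → ℕ → Set
IsCliqueNumber G k = HasClique G k × (∀ j → HasClique G j → j ≤ k)

Perfect : ∀ {n} → Graph n → Set
Perfect {n} G = ∀ m (f : Fin m → Fin n) → Injective f →
  ∃[ k ] (IsChromaticNumber (induced G f) k × IsCliqueNumber (induced G f) k)

Arcs : ℕ → Set
Arcs m = Fin m → Fin m → Bool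

Arc : ∀ {m} → Arcs m → Fin m → Fin m → Set
Arc a u v = a u v ≡ true

Ancestor : ∀ {m} → Arcs m → Fin m → Fin m → Set
Ancestor a = Star (Arc a)

Acyclic : ∀ {m} → Arcs m → Set
Acyclic a = ∀ u v → Arc a u v → ¬ Ancestor a v u

indeg outdeg : ∀ {m} → Arcs m → Fin m → ℕ
indeg  a v = count (λ u → a u v)
outdeg a v = count (λ w → a v w)

UAdj : ∀ {m} → Arcs m → Fin m → Fin m → Set
UAdj a u v = Arc a u v ⊎ Arc a v u

Mem : ∀ {m} → (Fin m → Bool) → Fin m → Set
Mem S x = S x ≡ true

PathIn : ∀ {m} → Arcs m → (Fin m → Set) → Fin m → Fin m → Set
PathIn a P u v = P u × P v × Star (λ x y → P x × P y × UAdj a x y) u v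

Biconnected : ∀ {m} → Arcs m → (Fin m → Bool) → Set
Biconnected a S = ∀ w u v → Mem S u → Mem S v → u ≢ w → v ≢ w →
  PathIn a (λ x → Mem S x × x ≢ w) u v

IsBlock : ∀ {m} → Arcs m → (Fin m → Bool) → Set
IsBlock a C = Biconnected a C ×
  (∀ (C' : Fin _ → Bool) → (∀ x → Mem C x → Mem C' x) → Biconnected a C' →
     ∀ x → Mem C' x → Mem C x)

HybridIn : ∀ {m} → Arcs m → (Fin m → Bool) → Fin m → Set
HybridIn a C h = indeg a h ≡ 2 × (∀ u → Arc a u h → Mem C u)

IsRoot : ∀ {m} → Arcs m → Fin m → Set
IsRoot a r = indeg a r ≡ 0

IsGalledTree : ∀ {m} → Arcs m → (Fin m → Set) → Set
IsGalledTree {m} a X =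
  (m ≡ 1 × (∀ u v → a u v ≡ false) × (∀ v → X v))
  ⊎
  ( Acyclic a
  × (∃[ r ] (IsRoot a r × 2 ≤ outdeg a r × (∀ r' → IsRoot a r' → r' ≡ r)))
  × (∀ x → X x ⇔′ (outdeg a x ≡ 0 × indeg a x ≡ 1))
  × (∀ v → ¬ IsRoot a v → ¬ X v →
        (indeg a v ≡ 1 × 2 ≤ outdeg a v) ⊎ (indeg a v ≡ 2 × 1 ≤ outdeg a v))
  × (∀ C → IsBlock a C → ∀ h h' → HybridIn a C h → HybridIn a C h' → h ≡ h'))

IsLCA : ∀ {m} → Arcs m → Fin m → Fin m → Fin m → Set
IsLCA a x y v = Ancestor a v x × Ancestor a v y ×
  (∀ w → Ancestor a w x → Ancestor a w y → Ancestor a v w → w ≡ v)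

data Label : Set where
  lab0 lab1 ⊙ : Label

-- G is GaTEx: G is isomorphic (via φ : Fin n → X) to the graph explained
-- by some labeled galled-tree (N, t) with vertex set Fin m and leaf set X
GaTEx : ∀ {n} → Graph n → Set
GaTEx {n} G =
  ∃[ m ] Σ (Arcs m) λ a → Σ (Fin m → Label) λ t → Σ (Fin n → Fin m) λ φ →
    let X = λ v → ∃[ x ] (φ x ≡ v) in
    Injective φ
    × IsGalledTree a X
    × (∀ v → (t v ≡ ⊙) ⇔′ X v)
    × (∀ x y → x ≢ y →
         Edge G x y ⇔′ (∃[ v ] (IsLCA a (φ x) (φ y) v × t v ≡ lab1)))

-- Call a graph reducible if it has a homogeneous set, or a vertex whose adjacency to all others is
-- constant with exactly one exception. Cycles of length at least 5 and their complements are
-- irreducible, and a minimal graph with χ ≠ ω is irreducible too (substitution, replication). So it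
-- suffices that any set S of at least two leaves of a galled-tree spans a reducible graph.
--
-- By N4, each vertex v is above at most one hybrid h having a parent outside the descendants of v;
-- hence lowest common ancestors are least. Let v be a lowest vertex above S. If the children of v
-- have disjoint parts of S below them, or two overlapping ones do not cover S, then S splits in two
-- with all adjacencies across equal, and a side with at least two leaves is homogeneous. Otherwise S
-- lies below a single cycle with top v and hybrid h, every leaf hanging off a path or below h.
-- Leaves with a common attachment point, the complement of a top leaf whose label agrees with that
-- of v, or the two topmost leaves of a path with equal labels form a homogeneous set. If none of
-- these occurs and some path carries two leaves, its second one has exactly one exceptional
-- adjacency; if each path carries one leaf, these two are twins.
module Submission where

open import Defs
open import Data.Nat using (ℕ; zero; suc; _+_; _*_; _≤_; _<_; z≤n; s≤s)
import Data.Nat as ℕ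
import Data.Nat.Properties as ℕₚ
open import Data.Nat.Induction using (<-wellFounded)
open import Data.Fin using (Fin; toℕ; fromℕ<)
import Data.Fin as F
open import Data.Fin.Properties
  using (_≟_; any?; all?; ¬∀⟶∃¬; suc-injective; injective⇒≤; toℕ-injective; toℕ<n; toℕ-fromℕ;
         toℕ-inject₁; toℕ-fromℕ<; fromℕ<-injective)
open import Data.Fin.Induction using (spo-wellFounded; spo-noetherian)
open import Data.Bool using (Bool; true; false; not; _∨_)
import Data.Bool.Properties as Boolₚ
open import Data.Maybe using (Maybe; just; nothing)
open import Data.Maybe.Properties using (just-injective) renaming (≡-dec to Maybe-≡-dec)
open import Data.Product using (∃; ∃-syntax; _×_; _,_; proj₁; proj₂)
open import Data.Sum using (_⊎_; inj₁; inj₂; [_,_]′)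
open import Data.Empty using (⊥; ⊥-elim)
open import Data.Unit using (⊤; tt)
open import Function using (_∘_; flip)
open import Induction.WellFounded using (Acc; acc; WellFounded)
open import Relation.Nullary using (¬_; Dec; yes; no; does; contradiction)
open import Relation.Nullary.Decidable
  using (¬?; _×-dec_; _⊎-dec_; dec-true; dec-false; decidable-stable; map′)
open import Relation.Unary using (Decidable)
open import Relation.Binary.Construct.Closure.ReflexiveTransitive as Star using (Star; ε; _◅_; _◅◅_)
open import Relation.Binary.Definitions using (tri<; tri≈; tri>)
open import Relation.Binary.PropositionalEquality as ≡
  using (_≡_; _≢_; refl; trans; cong; subst; ≢-sym)

private variable
  n m k : ℕ

-- Counting

does⇒ : ∀ {a} {A : Set a} (A? : Dec A) → does A? ≡ true → A
does⇒ (yes x) _ = x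

injection⇒≤ : (f : Fin m → Fin n) → Injective f → m ≤ n
injection⇒≤ f inj = injective⇒≤ {f = f} (λ {i} {j} → inj i j)

record Enumeration (p : Fin n → Bool) (k : ℕ) : Set where
  field
    elem     : Fin k → Fin n
    sound    : ∀ i → p (elem i) ≡ true
    distinct : Injective elem
    complete : ∀ {x} → p x ≡ true → ∃[ i ] elem i ≡ x

enumerate : (p : Fin n → Bool) → Enumeration p (count p)
enumerate {zero} p = record
  { elem = λ () ; sound = λ () ; distinct = λ () ; complete = λ { {()} } }
enumerate {suc n} p with p F.zero in eq | enumerate (p ∘ F.suc)
... | false | E = record
  { elem     = F.suc ∘ elem
  ; sound    = sound
  ; distinct = λ i j e → distinct i j (suc-injective e)
  ; complete = λ
      { {F.zero}  px → contradiction (trans (≡.sym px) eq) λ ()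
      ; {F.suc x} px → let i , e = complete px in i , cong F.suc e }
  }
  where open Enumeration E
... | true | E = record
  { elem     = λ { F.zero → F.zero ; (F.suc i) → F.suc (elem i) }
  ; sound    = λ { F.zero → eq ; (F.suc i) → sound i }
  ; distinct = λ where
      F.zero    F.zero    _ → refl
      (F.suc i) (F.suc j) e → cong F.suc (distinct i j (suc-injective e))
  ; complete = λ
      { {F.zero}  px → F.zero , refl
      ; {F.suc x} px → let i , e = complete px in F.suc i , cong F.suc e }
  }
  where open Enumeration E

injection⇒≤count : (p : Fin n → Bool) (f : Fin m → Fin n) → Injective f →
                   (∀ i → p (f i) ≡ true) → m ≤ count p
injection⇒≤count p f inj pf = injection⇒≤ index λ i j e → inj i j
    (trans (≡.sym (elem-index i)) (trans (cong elem e) (elem-index j)))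
  where
  open Enumeration (enumerate p)
  index = λ i → proj₁ (complete (pf i))
  elem-index = λ i → proj₂ (complete (pf i))

cons : Fin n → (Fin m → Fin n) → Fin (suc m) → Fin n
cons x f F.zero    = x
cons x f (F.suc i) = f i

cons-injective : {x : Fin n} {f : Fin m → Fin n} → (∀ i → f i ≢ x) → Injective f →
                 Injective (cons x f)
cons-injective f≢x inj F.zero    F.zero    _ = refl
cons-injective f≢x inj F.zero    (F.suc j) e = contradiction (≡.sym e) (f≢x j)
cons-injective f≢x inj (F.suc i) F.zero    e = contradiction e (f≢x i)
cons-injective f≢x inj (F.suc i) (F.suc j) e = cong F.suc (inj i j e)

count-strict : (p q : Fin n → Bool) → (∀ x → p x ≡ true → q x ≡ true) →
               ∀ x → p x ≡ false → q x ≡ true → count p < count q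
count-strict p q p⊆q x ¬px qx =
  injection⇒≤count q (cons x elem)
    (cons-injective (λ i e → contradiction (trans (≡.sym (sound i)) (trans (cong p e) ¬px)) λ ()) distinct)
    λ { F.zero → qx ; (F.suc i) → p⊆q _ (sound i) }
  where open Enumeration (enumerate p)

count-<-size : (p : Fin n → Bool) → ∀ x → p x ≡ false → count p < n
count-<-size p x ¬px = injection⇒≤ (cons x elem)
    (cons-injective (λ i e → contradiction (trans (≡.sym (sound i)) (trans (cong p e) ¬px)) λ ()) distinct)
  where open Enumeration (enumerate p)

1≤count : (p : Fin m → Bool) → ∀ {x} → p x ≡ true → 1 ≤ count p
1≤count p {x} px = injection⇒≤count p (λ (_ : Fin 1) → x) (λ { F.zero F.zero _ → refl }) λ _ → px

2≤count : (p : Fin m → Bool) → ∀ {x y} → p x ≡ true → p y ≡ true → x ≢ y → 2 ≤ count p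
2≤count p {x} {y} px py x≢y = injection⇒≤count p (cons x λ _ → y)
  (cons-injective (λ _ → ≢-sym x≢y) λ { F.zero F.zero _ → refl }) λ { F.zero → px ; (F.suc _) → py }

3≤count : (p : Fin m → Bool) → ∀ {x y z} → p x ≡ true → p y ≡ true → p z ≡ true →
          x ≢ y → x ≢ z → y ≢ z → 3 ≤ count p
3≤count p {x} {y} {z} px py pz x≢y x≢z y≢z = injection⇒≤count p (cons x (cons y λ _ → z))
  (cons-injective (λ { F.zero → ≢-sym x≢y ; (F.suc _) → ≢-sym x≢z })
    (cons-injective (λ _ → ≢-sym y≢z) λ { F.zero F.zero _ → refl }))
  λ { F.zero → px ; (F.suc F.zero) → py ; (F.suc (F.suc _)) → pz }

-- Reducible graphs

data Reducible (G : Graph n) : Set₁ where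
  homogeneous : {M : Fin n → Set} → Decidable M →
    ∀ {x x′ s} → x ≢ x′ → M x → M x′ → ¬ M s →
    (∀ {u u′ y} → M u → M u′ → ¬ M y → adj G u y ≡ adj G u′ y) →
    Reducible G
  near-uniform : ∀ ρ {x y} → x ≢ y → adj G x y ≡ not ρ →
    (∀ w → w ≢ x → w ≢ y → adj G x w ≡ ρ) → Reducible G

HereditarilyReducible : Graph n → Set₁
HereditarilyReducible {n} G =
  ∀ {k} → 2 ≤ k → (f : Fin k → Fin n) → Injective f → Reducible (induced G f)

edge-sym : (G : Graph n) → ∀ {x y} → Edge G x y → Edge G y x
edge-sym G = trans (Graph.sym G _ _)

edge⇒≢ : (G : Graph n) → ∀ {x y} → Edge G x y → x ≢ y
edge⇒≢ G e refl = contradiction (trans (≡.sym e) (irrefl G _)) λ ()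

twins : (G : Graph n) → ∀ {x y s} → x ≢ y → s ≢ x → s ≢ y →
        (∀ w → w ≢ x → w ≢ y → adj G x w ≡ adj G y w) → Reducible G
twins G {x} {y} x≢y s≢x s≢y same =
  homogeneous (λ w → (w ≟ x) ⊎-dec (w ≟ y)) x≢y (inj₁ refl) (inj₂ refl) [ s≢x , s≢y ]′ λ where
    (inj₁ refl) (inj₁ refl) w∉ → refl
    (inj₁ refl) (inj₂ refl) w∉ → same _ (w∉ ∘ inj₁) (w∉ ∘ inj₂)
    (inj₂ refl) (inj₁ refl) w∉ → ≡.sym (same _ (w∉ ∘ inj₁) (w∉ ∘ inj₂))
    (inj₂ refl) (inj₂ refl) w∉ → refl

-- A side with at least two vertices is homogeneous, because all adjacencies leaving it are equal
-- and the other side is nonempty.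
uniform-split : (G : Graph n) {M : Fin n → Set} → Decidable M → ∀ ρ {x s} → M x → ¬ M s →
                (∀ {u y} → M u → ¬ M y → adj G u y ≡ ρ) → Reducible G
uniform-split {n} G {M} M? ρ {x} {s} Mx ¬Ms cross
  with any? (λ x′ → M? x′ ×-dec ¬? (x ≟ x′)) | any? (λ s′ → ¬? (M? s′) ×-dec ¬? (s ≟ s′))
... | yes (x′ , Mx′ , x≢x′) | _ =
  homogeneous M? x≢x′ Mx Mx′ ¬Ms λ Mu Mu′ ¬My → trans (cross Mu ¬My) (≡.sym (cross Mu′ ¬My))
... | no _ | yes (s′ , ¬Ms′ , s≢s′) =
  homogeneous (λ y → ¬? (M? y)) s≢s′ ¬Ms ¬Ms′ (λ ¬Mx → ¬Mx Mx) λ ¬Mu ¬Mu′ ¬¬My →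
    trans (cross′ ¬Mu ¬¬My) (≡.sym (cross′ ¬Mu′ ¬¬My))
  where
  cross′ : ∀ {u y} → ¬ M u → ¬ ¬ M y → adj G u y ≡ ρ
  cross′ ¬Mu ¬¬My = trans (Graph.sym G _ _) (cross (decidable-stable (M? _) ¬¬My) ¬Mu)
... | no single | no single′ =
  -- Both sides are singletons, so `x` and `s` are the whole graph: their adjacency is declared the
  -- exception and no further vertex has to comply.
  near-uniform (not (adj G x s)) (λ { refl → ¬Ms Mx }) (≡.sym (Boolₚ.not-involutive _)) only
  where
  only : ∀ w → w ≢ x → w ≢ s → adj G x w ≡ not (adj G x s)
  only w w≢x w≢s with M? w
  ... | yes Mw = contradiction (w , Mw , ≢-sym w≢x) single
  ... | no ¬Mw = contradiction (w , ¬Mw , ≢-sym w≢s) single′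

-- Holes and anti-holes are irreducible

-- β = true for a hole and β = false for an anti-hole.
record Cyclic (G : Graph n) (β : Bool) : Set₁ where
  field
    _⇝_ : Fin n → Fin n → Set
    nxt prv : Fin n → Fin n
    nxt-⇝ : ∀ i → i ⇝ nxt i
    prv-⇝ : ∀ i → prv i ⇝ i
    functional : ∀ {i j j′} → i ⇝ j → i ⇝ j′ → j ≡ j′
    injective  : ∀ {i i′ j} → i ⇝ j → i′ ⇝ j → i ≡ i′
    no-loop : ∀ {i} → ¬ i ⇝ i
    no-2cycle : ∀ {i j} → i ⇝ j → ¬ j ⇝ i
    no-3cycle : ∀ {i j k} → i ⇝ j → j ⇝ k → ¬ k ⇝ i
    no-4cycle : ∀ {i j k l} → i ⇝ j → j ⇝ k → k ⇝ l → ¬ l ⇝ i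
    adj⇒ : ∀ {i j} → i ≢ j → adj G i j ≡ β → i ⇝ j ⊎ j ⇝ i
    ⇒adj : ∀ {i j} → i ⇝ j ⊎ j ⇝ i → adj G i j ≡ β

  ⇝⇒≢ : ∀ {i j} → i ⇝ j → i ≢ j
  ⇝⇒≢ i⇝j refl = no-loop i⇝j

  ⇝⇝⇒≢ : ∀ {i j k} → i ⇝ j → j ⇝ k → i ≢ k
  ⇝⇝⇒≢ i⇝j j⇝k refl = no-2cycle i⇝j j⇝k

  x≢x₃ : ∀ x → x ≢ nxt (nxt (nxt x))
  x≢x₃ x e = no-3cycle (nxt-⇝ x) (nxt-⇝ (nxt x)) (subst (nxt (nxt x) ⇝_) (≡.sym e) (nxt-⇝ (nxt (nxt x))))

  adj⇒-prv : ∀ {i j k} → i ⇝ j → k ≢ j → k ≢ i → adj G j k ≡ β → j ⇝ k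
  adj⇒-prv i⇝j k≢j k≢i e with adj⇒ (≢-sym k≢j) e
  ... | inj₁ j⇝k = j⇝k
  ... | inj₂ k⇝j = contradiction (injective k⇝j i⇝j) k≢i

  not-adjacent : ∀ {i j k l} → i ⇝ j → j ⇝ k → k ⇝ l → adj G i k ≢ β
  not-adjacent i⇝j j⇝k k⇝l e with adj⇒ (⇝⇝⇒≢ i⇝j j⇝k) e
  ... | inj₁ i⇝k = no-loop (subst (_⇝ _) (functional i⇝j i⇝k) j⇝k)
  ... | inj₂ k⇝i = no-3cycle i⇝j j⇝k k⇝i

  -- If `ρ` differs from `β`, both cycle neighbours of `x` would have to be `y`. If `ρ` is `β`, the
  -- second and third successors of `x`, which are not its cycle neighbours, would both have to be
  -- `y`.
  no-near-uniform : ∀ ρ {x y} → (∀ w → w ≢ x → w ≢ y → adj G x w ≡ ρ) → adj G x y ≡ not ρ → ⊥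
  no-near-uniform ρ {x} {y} rest xy with ρ Boolₚ.≟ β
  ... | no ρ≢β = ⇝⇝⇒≢ (prv-⇝ x) (nxt-⇝ x)
        (trans (must-be-y (⇝⇒≢ (prv-⇝ x)) (inj₂ (prv-⇝ x)))
               (≡.sym (must-be-y (≢-sym (⇝⇒≢ (nxt-⇝ x))) (inj₁ (nxt-⇝ x)))))
    where
    must-be-y : ∀ {w} → w ≢ x → x ⇝ w ⊎ w ⇝ x → w ≡ y
    must-be-y {w} w≢x w~x with w ≟ y
    ... | yes e = e
    ... | no w≢y = contradiction (trans (≡.sym (rest w w≢x w≢y)) (⇒adj w~x)) ρ≢β
  ... | yes refl with nxt (nxt x) ≟ y
  ...   | no  ≢y = not-adjacent (nxt-⇝ x) (nxt-⇝ _) (nxt-⇝ _)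
                     (rest _ (≢-sym (⇝⇝⇒≢ (nxt-⇝ x) (nxt-⇝ _))) ≢y)
  ...   | yes refl with adj⇒ (x≢x₃ x) (rest (nxt (nxt (nxt x))) (≢-sym (x≢x₃ x)) (≢-sym (⇝⇒≢ (nxt-⇝ _))))
  ...     | inj₁ x⇝ = ⇝⇝⇒≢ (nxt-⇝ (nxt x)) (nxt-⇝ _) (functional (nxt-⇝ x) x⇝)
  ...     | inj₂ ⇝x = no-4cycle (nxt-⇝ x) (nxt-⇝ _) (nxt-⇝ _) ⇝x

  -- Every member of `M` other than `p` is `β`-adjacent to `q`, hence the successor of `q`. If the
  -- predecessor `r` of `p` is in `M`, this closes a 3-cycle. If not, a second member of `M` is a
  -- cycle neighbour of `r`, which closes a 4-cycle or makes that member equal to `p`.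
  no-homogeneous : {M : Fin n → Set} → Decidable M → ∀ {x x′ p q} → x ≢ x′ → M x → M x′ →
    M p → ¬ M q → p ⇝ q →
    (∀ {u u′ y} → M u → M u′ → ¬ M y → adj G u y ≡ adj G u′ y) → ⊥
  no-homogeneous {M} M? {x} {x′} {p} {q} x≢x′ Mx Mx′ Mp ¬Mq p⇝q same = go (M? r)
    where
    r = prv p
    r⇝p = prv-⇝ p
    q⇝ : ∀ {u} → M u → u ≢ p → q ⇝ u
    q⇝ Mu u≢p = adj⇒-prv p⇝q (λ { refl → ¬Mq Mu }) u≢p
      (trans (Graph.sym G _ _) (trans (same Mu Mp ¬Mq) (⇒adj (inj₁ p⇝q))))
    another : ∃[ p′ ] M p′ × p′ ≢ p
    another with x ≟ p
    ... | yes refl = x′ , Mx′ , ≢-sym x≢x′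
    ... | no x≢p   = x , Mx , x≢p
    go : Dec (M r) → ⊥
    go (yes Mr) = no-3cycle r⇝p p⇝q (q⇝ Mr (⇝⇒≢ r⇝p))
    go (no ¬Mr) with another
    ... | p′ , Mp′ , p′≢p with adj⇒ (λ { refl → ¬Mr Mp′ }) (trans (same Mp′ Mp ¬Mr) (⇒adj (inj₂ r⇝p)))
    ...   | inj₁ p′⇝r = no-4cycle r⇝p p⇝q (q⇝ Mp′ p′≢p) p′⇝r
    ...   | inj₂ r⇝p′ = p′≢p (functional r⇝p′ r⇝p)

-- Serves to apply `no-homogeneous` where the cycle enters `M` instead of leaving it.
reverse : {G : Graph n} {β : Bool} → Cyclic G β → Cyclic G β
reverse C = record
  { _⇝_ = λ i j → j ⇝ i
  ; nxt = prv ; prv = nxt ; nxt-⇝ = prv-⇝ ; prv-⇝ = nxt-⇝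
  ; functional = injective ; injective = functional
  ; no-loop = no-loop ; no-2cycle = no-2cycle
  ; no-3cycle = λ p q r → no-3cycle q p r
  ; no-4cycle = λ p q r s → no-4cycle r q p s
  ; adj⇒ = λ i≢j e → [ inj₂ , inj₁ ]′ (adj⇒ i≢j e)
  ; ⇒adj = ⇒adj ∘ [ inj₂ , inj₁ ]′
  }
  where open Cyclic C

boundary : {M : Fin (suc n) → Set} → Decidable M → ∀ {x s} → M x → ¬ M s →
           ∃[ i ] ∃[ j ] (suc (toℕ i) ≡ toℕ j) × (M i × ¬ M j ⊎ ¬ M i × M j)
boundary {zero} M? {F.zero} {F.zero} Mx ¬Ms = contradiction Mx ¬Ms
boundary {suc n} {M} M? {x} {s} Mx ¬Ms with M? F.zero | M? (F.suc F.zero)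
... | yes M0 | no ¬M1 = F.zero , F.suc F.zero , refl , inj₁ (M0 , ¬M1)
... | no ¬M0 | yes M1 = F.zero , F.suc F.zero , refl , inj₂ (¬M0 , M1)
-- Position 1 is the member of `M` passed to the tail, since `x` may be the position that is
-- dropped.
... | yes M0 | yes M1 with s
...   | F.zero = contradiction M0 ¬Ms
...   | F.suc s′ = let i , j , e , b = boundary (M? ∘ F.suc) M1 ¬Ms
                   in F.suc i , F.suc j , cong suc e , b
boundary {suc n} {M} M? {x} {s} Mx ¬Ms | no ¬M0 | no ¬M1 with x
...   | F.zero = contradiction Mx ¬M0
...   | F.suc x′ = let i , j , e , b = boundary (M? ∘ F.suc) Mx ¬M1
                   in F.suc i , F.suc j , cong suc e , b

-- Arithmetic of the cyclic successor

module _ (n : ℕ) where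

  CycSucc-functional : ∀ {i j j′} → CycSucc n i j → CycSucc n i j′ → j ≡ j′
  CycSucc-functional (inj₁ p) (inj₁ q) = toℕ-injective (trans (≡.sym p) q)
  CycSucc-functional {j = j} (inj₁ p) (inj₂ (q , _)) =
    contradiction (trans (≡.sym p) q) (ℕₚ.<⇒≢ (toℕ<n j))
  CycSucc-functional {j′ = j′} (inj₂ (q , _)) (inj₁ p) =
    contradiction (trans (≡.sym p) q) (ℕₚ.<⇒≢ (toℕ<n j′))
  CycSucc-functional (inj₂ (_ , p)) (inj₂ (_ , q)) = toℕ-injective (trans p (≡.sym q))

  CycSucc-injective : ∀ {i i′ j} → CycSucc n i j → CycSucc n i′ j → i ≡ i′
  CycSucc-injective (inj₁ p) (inj₁ q) = toℕ-injective (ℕₚ.suc-injective (trans p (≡.sym q)))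
  CycSucc-injective (inj₁ p) (inj₂ (_ , q)) = contradiction (trans p q) λ ()
  CycSucc-injective (inj₂ (_ , q)) (inj₁ p) = contradiction (trans p q) λ ()
  CycSucc-injective (inj₂ (p , _)) (inj₂ (q , _)) =
    toℕ-injective (ℕₚ.suc-injective (trans p (≡.sym q)))

  -- A congruence modulo `n` in equational form. Chained by `step-trans`, a closed walk of length
  -- `l` makes `l` a multiple of `n`, which `short-cycle` refutes for 0 < l < n.
  CycSucc-step : ∀ {i j} → CycSucc n i j → ∃[ c ] suc (toℕ i) ≡ toℕ j + c * n
  CycSucc-step (inj₁ p) = 0 , trans p (≡.sym (ℕₚ.+-identityʳ _))
  CycSucc-step {j = j} (inj₂ (p , q)) = 1 , trans p (trans (≡.sym (ℕₚ.*-identityˡ n)) (cong (_+ 1 * n) (≡.sym q)))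

  step-trans : ∀ {a b c l} → ∃[ e ] suc a ≡ b + e * n → ∃[ e ] (l + b ≡ c + e * n) →
               ∃[ e ] suc l + a ≡ c + e * n
  step-trans {a} {b} {c} {l} (e , p) (e′ , q) = e′ + e , (begin
    suc l + a            ≡⟨ ℕₚ.+-suc l a ⟨
    l + suc a            ≡⟨ cong (l +_) p ⟩
    l + (b + e * n)      ≡⟨ ℕₚ.+-assoc l b _ ⟨
    l + b + e * n        ≡⟨ cong (_+ e * n) q ⟩
    c + e′ * n + e * n   ≡⟨ ℕₚ.+-assoc c _ _ ⟩
    c + (e′ * n + e * n) ≡⟨ cong (c +_) (ℕₚ.*-distribʳ-+ n e′ e) ⟨
    c + (e′ + e) * n     ∎)
    where open ≡.≡-Reasoning

  short-cycle : ∀ {a} l → 0 < l → l < n → ¬ (∃[ e ] l + a ≡ a + e * n)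
  short-cycle {a} l 0<l l<n (e , p) = impossible e (ℕₚ.+-cancelˡ-≡ a l (e * n) (trans (ℕₚ.+-comm a l) p))
    where
    impossible : ∀ e → l ≢ e * n
    impossible zero    q = ℕₚ.<⇒≢ 0<l (≡.sym q)
    impossible (suc e) q = ℕₚ.<⇒≱ l<n (subst (n ≤_) (≡.sym q) (ℕₚ.m≤m+n n (e * n)))

cycNext : (i : Fin n) → ∃[ j ] CycSucc n i j
cycNext {suc n} i with suc (toℕ i) ℕₚ.≟ suc n
... | yes e = F.zero , inj₂ (e , refl)
... | no ≢n = fromℕ< i<n , inj₁ (≡.sym (toℕ-fromℕ< i<n))
  where i<n = ℕₚ.≤∧≢⇒< (toℕ<n i) ≢n

cycPrev : (j : Fin n) → ∃[ i ] CycSucc n i j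
cycPrev {suc n} F.zero = F.fromℕ n , inj₂ (cong suc (toℕ-fromℕ n) , refl)
cycPrev {suc n} (F.suc j) = F.inject₁ j , inj₁ (cong suc (toℕ-inject₁ j))

cyclic : {G : Graph n} {β : Bool} → 5 ≤ n → (∀ i j → i ≢ j → adj G i j ≡ β → CycAdj n i j) →
         (∀ i j → CycAdj n i j → adj G i j ≡ β) → Cyclic G β
cyclic {n} 5≤n adj⇒ ⇒adj = record
  { _⇝_ = CycSucc n
  ; nxt = λ i → proj₁ (cycNext i) ; prv = λ i → proj₁ (cycPrev i)
  ; nxt-⇝ = λ i → proj₂ (cycNext i) ; prv-⇝ = λ i → proj₂ (cycPrev i)
  ; functional = CycSucc-functional n ; injective = CycSucc-injective n
  ; no-loop = λ p → short-cycle n 1 (s≤s z≤n) (ℕₚ.≤-trans (ℕₚ.m≤m+n 2 3) 5≤n)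
      (step p)
  ; no-2cycle = λ p q → short-cycle n 2 (s≤s z≤n) (ℕₚ.≤-trans (ℕₚ.m≤m+n 3 2) 5≤n)
      (step-trans n (step p) (step q))
  ; no-3cycle = λ p q r → short-cycle n 3 (s≤s z≤n) (ℕₚ.≤-trans (ℕₚ.m≤m+n 4 1) 5≤n)
      (step-trans n (step p) (step-trans n (step q) (step r)))
  ; no-4cycle = λ p q r s → short-cycle n 4 (s≤s z≤n) 5≤n
      (step-trans n (step p) (step-trans n (step q) (step-trans n (step r) (step s))))
  ; adj⇒ = adj⇒ _ _ ; ⇒adj = ⇒adj _ _
  }
  where
  step = CycSucc-step n

cyclic-irreducible : (G : Graph n) {β : Bool} → 5 ≤ n → 
  (∀ i j → i ≢ j → adj G i j ≡ β → CycAdj n i j) →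
  (∀ i j → CycAdj n i j → adj G i j ≡ β) → ¬ Reducible G
cyclic-irreducible G 5≤n adj⇒ ⇒adj (near-uniform ρ x≢y xy rest) =
  Cyclic.no-near-uniform (cyclic {G = G} 5≤n adj⇒ ⇒adj) ρ rest xy
cyclic-irreducible {suc n} G 5≤n adj⇒ ⇒adj (homogeneous M? x≢x′ Mx Mx′ ¬Ms same)
  with boundary M? Mx ¬Ms
... | i , j , e , inj₁ (Mi , ¬Mj) =
  Cyclic.no-homogeneous (cyclic {G = G} 5≤n adj⇒ ⇒adj) M? x≢x′ Mx Mx′ Mi ¬Mj (inj₁ e) same
... | i , j , e , inj₂ (¬Mi , Mj) =
  Cyclic.no-homogeneous (reverse (cyclic {G = G} 5≤n adj⇒ ⇒adj)) M? x≢x′ Mx Mx′ Mj ¬Mi (inj₁ e) same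

CycAdj? : (i j : Fin n) → Dec (CycAdj n i j)
CycAdj? {n} i j = succ? i j ⊎-dec succ? j i
  where
  succ? : ∀ i j → Dec (CycSucc n i j)
  succ? i j = (suc (toℕ i) ℕₚ.≟ toℕ j) ⊎-dec ((suc (toℕ i) ℕₚ.≟ n) ×-dec (toℕ j ℕₚ.≟ 0))

2≤ : 5 ≤ k → 2 ≤ k
2≤ = ℕₚ.≤-trans (ℕₚ.m≤m+n 2 3)

weaklyChordal : (G : Graph n) → HereditarilyReducible G → WeaklyChordal G
weaklyChordal G red =
  (λ k f (5≤k , inj , iff) →
    cyclic-irreducible (induced G f) 5≤k (λ i j _ → proj₁ (iff i j)) (λ i j → proj₂ (iff i j))
      (red (2≤ 5≤k) f inj)) ,
  (λ k f (5≤k , inj , iff) →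
    cyclic-irreducible (induced G f) {false} 5≤k
      (λ i j i≢j ≡false → decidable-stable (CycAdj? i j) λ ¬cyc →
        contradiction (trans (≡.sym (proj₂ (iff i j i≢j) ¬cyc)) ≡false) λ ())
      (λ i j cyc → Boolₚ.¬-not λ ≡true → proj₁ (iff i j (cycAdj⇒≢ 5≤k cyc)) ≡true cyc)
      (red (2≤ 5≤k) f inj))
  where
  no-loop : 5 ≤ k → ∀ {i} → ¬ CycSucc k i i
  no-loop {k} 5≤k p = short-cycle k 1 (s≤s z≤n) (2≤ 5≤k) (CycSucc-step k p)
  cycAdj⇒≢ : 5 ≤ k → ∀ {i j} → CycAdj k i j → i ≢ j
  cycAdj⇒≢ 5≤k (inj₁ p) refl = no-loop 5≤k p
  cycAdj⇒≢ 5≤k (inj₂ p) refl = no-loop 5≤k p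

-- Perfection

-- A clique and a colouring of the same size certify χ = ω on the part `S`. Colours are natural
-- numbers, arbitrary outside `S`, so that certificates of different parts combine without renaming
-- vertices.
record Tight (G : Graph n) (S : Fin n → Set) : Set where
  field
    size   : ℕ
    clique : Fin size → Fin n
    clique-injective : Injective clique
    clique-in  : ∀ i → S (clique i)
    clique-adj : ∀ i j → i ≢ j → Edge G (clique i) (clique j)
    colour : Fin n → ℕ
    colour< : ∀ {x} → S x → colour x < size
    proper  : ∀ {x y} → S x → S y → Edge G x y → colour x ≢ colour y

cons-adj : (G : Graph n) {x : Fin n} {f : Fin k → Fin n} → (∀ i → Edge G x (f i)) →
           (∀ i j → i ≢ j → Edge G (f i) (f j)) →
           ∀ i j → i ≢ j → Edge G (cons x f i) (cons x f j)
cons-adj G x-f f-f F.zero    F.zero    i≢j = contradiction refl i≢j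
cons-adj G x-f f-f F.zero    (F.suc j) i≢j = x-f j
cons-adj G x-f f-f (F.suc i) F.zero    i≢j = edge-sym G (x-f i)
cons-adj G x-f f-f (F.suc i) (F.suc j) i≢j = f-f i j (i≢j ∘ cong F.suc)

colours-injective⇒≤ : {c : Fin n → ℕ} {f : Fin k → Fin n} → (∀ i → c (f i) < m) →
  (∀ i j → i ≢ j → c (f i) ≢ c (f j)) → k ≤ m
colours-injective⇒≤ c< c≢ = injection⇒≤ (λ i → fromℕ< (c< i)) λ i j e →
  decidable-stable (i ≟ j) λ i≢j → c≢ i j i≢j (fromℕ<-injective _ _ (c< i) (c< j) e)

module _ {G : Graph n}
         (proper-part : {S : Fin n → Set} → Decidable S → ∀ {s} → ¬ S s → Tight G S) where

  private
    Whole : Fin n → Set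
    Whole _ = ⊤

  -- Lovász's replication argument: the colour class A of x in G − x′ is given a colour of its own
  -- in G, since a maximum clique of G − A either contains x′ and extends by x, or avoids x′ and
  -- then misses a colour of G − x′.
  tight-true-twins : ∀ {x x′} → Edge G x x′ → (∀ w → w ≢ x → Edge G x′ w → Edge G x w) →
                     Tight G Whole
  tight-true-twins {x} {x′} xx′ dom = result
    where
    module C = Tight (proper-part (λ y → ¬? (y ≟ x′)) (λ ≢ → ≢ refl))
    c = C.colour
    x≢x′ = edge⇒≢ G xx′
    A : Fin n → Set
    A y = y ≢ x′ × c y ≡ c x
    A? : Decidable A
    A? y = ¬? (y ≟ x′) ×-dec (c y ℕₚ.≟ c x)
    module R = Tight (proper-part (λ y → ¬? (A? y)) {x} (λ ¬Ax → ¬Ax (x≢x′ , refl)))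
    colour′ : Fin n → ℕ
    colour′ y with A? y
    ... | yes _ = R.size
    ... | no  _ = R.colour y
    colour′< : ∀ y → colour′ y < suc R.size
    colour′< y with A? y
    ... | yes _ = ℕₚ.≤-refl
    ... | no ¬Ay = ℕₚ.m<n⇒m<1+n (R.colour< ¬Ay)
    proper′ : ∀ {y z} → Edge G y z → colour′ y ≢ colour′ z
    proper′ {y} {z} yz with A? y | A? z
    ... | yes (y≢ , cy) | yes (z≢ , cz) = λ _ → C.proper y≢ z≢ yz (trans cy (≡.sym cz))
    ... | yes _  | no ¬Az = ≢-sym (ℕₚ.<⇒≢ (R.colour< ¬Az))
    ... | no ¬Ay | yes _  = ℕₚ.<⇒≢ (R.colour< ¬Ay)
    ... | no ¬Ay | no ¬Az = R.proper ¬Ay ¬Az yz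
    result : Tight G Whole
    result with any? (λ i → R.clique i ≟ x′)
    ... | yes (i , ≡x′) = record
      { size = suc R.size
      ; clique = cons x R.clique
      ; clique-injective = cons-injective clique≢x R.clique-injective
      ; clique-in = λ _ → tt
      ; clique-adj = cons-adj G x-clique R.clique-adj
      ; colour = colour′ ; colour< = λ {y} _ → colour′< y ; proper = λ _ _ → proper′
      }
      where
      clique≢x : ∀ j → R.clique j ≢ x
      clique≢x j e = R.clique-in j (subst A (≡.sym e) (x≢x′ , refl))
      x-clique : ∀ j → Edge G x (R.clique j)
      x-clique j with i ≟ j
      ... | yes refl = subst (Edge G x) (≡.sym ≡x′) xx′
      ... | no i≢j = dom _ (clique≢x j) (subst (λ z → Edge G z (R.clique j)) ≡x′ (R.clique-adj i j i≢j))
    ... | no ∌x′ = record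
      { size = C.size ; clique = C.clique ; clique-injective = C.clique-injective
      ; clique-in = λ _ → tt ; clique-adj = C.clique-adj
      ; colour = colour′ ; colour< = λ {y} _ → ℕₚ.<-≤-trans (colour′< y) size<k
      ; proper = λ _ _ → proper′
      }
      where
      R-in : ∀ i → R.clique i ≢ x′
      R-in i e = ∌x′ (i , e)
      c≢x : ∀ i → c (R.clique i) ≢ c x
      c≢x i e = R.clique-in i (R-in i , e)
      size<k : suc R.size ≤ C.size
      -- The clique avoids the colour class of `x`, so its vertices together with `x` have pairwise
      -- different colours in G - x′.
      size<k = colours-injective⇒≤ {c = c} {f = cons x R.clique}
        (λ { F.zero → C.colour< x≢x′ ; (F.suc i) → C.colour< (R-in i) })
        λ where
          F.zero    F.zero    i≢j → contradiction refl i≢j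
          F.zero    (F.suc j) i≢j → ≢-sym (c≢x j)
          (F.suc i) F.zero    i≢j → c≢x i
          (F.suc i) (F.suc j) i≢j → C.proper (R-in i) (R-in j) (R.clique-adj i j (i≢j ∘ cong F.suc))

  -- A homogeneous set that is not a clique is contracted to one of its maximum cliques, which
  -- leaves a proper part of G; inside a homogeneous clique, x and x′ are true twins.
  tight-homogeneous : {M : Fin n → Set} → Decidable M →
    ∀ {x x′ s} → x ≢ x′ → M x → M x′ → ¬ M s →
    (∀ {u u′ y} → M u → M u′ → ¬ M y → adj G u y ≡ adj G u′ y) → Tight G Whole
  tight-homogeneous {M} M? {x} {x′} x≢x′ Mx Mx′ ¬Ms same
    with any? (λ y → M? y ×-dec ¬? (any? (λ i → Tight.clique (proper-part M? ¬Ms) i ≟ y)))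
  ... | no M⊆K = tight-true-twins (M-clique Mx Mx′ x≢x′) dom
    where
    module K = Tight (proper-part M? ¬Ms)
    inK : ∀ {y} → M y → ∃[ i ] K.clique i ≡ y
    inK {y} My = decidable-stable (any? (λ i → K.clique i ≟ y)) λ ∉K → M⊆K (y , My , ∉K)
    M-clique : ∀ {y z} → M y → M z → y ≢ z → Edge G y z
    M-clique My Mz y≢z with inK My | inK Mz
    ... | i , refl | j , refl = K.clique-adj i j λ { refl → y≢z refl }
    dom : ∀ w → w ≢ x → Edge G x′ w → Edge G x w
    dom w w≢x x′w with M? w
    ... | yes Mw = M-clique Mx Mw (≢-sym w≢x)
    ... | no ¬Mw = trans (same Mx Mx′ ¬Mw) x′w
  ... | yes (y₀ , My₀ , y₀∉K) = record
    { size = R.size ; clique = R.clique ; clique-injective = R.clique-injective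
    ; clique-in = λ _ → tt ; clique-adj = R.clique-adj
    ; colour = λ y → R.colour (rep y) ; colour< = λ {y} _ → R.colour< (rep-in y)
    ; proper = λ _ _ yz → R.proper (rep-in _) (rep-in _) (rep-adj yz)
    }
    where
    module K = Tight (proper-part M? ¬Ms)
    InK : Fin n → Set
    InK y = ∃[ i ] K.clique i ≡ y
    inK? : Decidable InK
    inK? y = any? (λ i → K.clique i ≟ y)
    module R = Tight (proper-part (λ y → ¬? (M? y) ⊎-dec inK? y)
                        {y₀} [ (λ ¬My₀ → ¬My₀ My₀) , y₀∉K ]′)
    -- A homomorphism into the contracted part: a member of `M` goes to the clique vertex indexed by
    -- its colour, so adjacent members go to different vertices of the clique.
    rep : Fin n → Fin n
    rep y with M? y
    ... | yes My = K.clique (fromℕ< (K.colour< My))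
    ... | no  _  = y
    rep-in : ∀ y → ¬ M (rep y) ⊎ InK (rep y)
    rep-in y with M? y
    ... | yes _  = inj₂ (_ , refl)
    ... | no ¬My = inj₁ ¬My
    rep-adj : ∀ {y z} → Edge G y z → Edge G (rep y) (rep z)
    rep-adj {y} {z} yz with M? y | M? z
    ... | yes My | yes Mz = K.clique-adj _ _ λ e → K.proper My Mz yz (fromℕ<-injective _ _ _ _ e)
    ... | yes My | no ¬Mz = trans (same (K.clique-in _) My ¬Mz) yz
    ... | no ¬My | yes Mz = edge-sym G (trans (same (K.clique-in _) Mz ¬My) (edge-sym G yz))
    ... | no _   | no _   = yz

  -- For `ρ = true`, `x` extends a maximum clique of the graph without `x` and `y`, and these two
  -- share one new colour. For `ρ = false`, `x` is pendant at `y` and takes any colour but that of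
  -- `y`, for which two colours suffice.
  tight-near-uniform : ∀ ρ {x y} → x ≢ y → adj G x y ≡ not ρ →
    (∀ w → w ≢ x → w ≢ y → adj G x w ≡ ρ) → Tight G Whole
  tight-near-uniform true {x} {y} x≢y ¬xy rest = record
    { size = suc R.size
    ; clique = cons x R.clique
    ; clique-injective = cons-injective (λ i → proj₁ (R.clique-in i)) R.clique-injective
    ; clique-in = λ _ → tt
    ; clique-adj = cons-adj G (λ i → rest _ (proj₁ (R.clique-in i)) (proj₂ (R.clique-in i))) R.clique-adj
    ; colour = colour′ ; colour< = λ {w} _ → colour′< w ; proper = λ _ _ → proper′
    }
    where
    other? : Decidable (λ w → w ≢ x × w ≢ y)
    other? w = ¬? (w ≟ x) ×-dec ¬? (w ≟ y)
    module R = Tight (proper-part other? {x} (λ (≢x , _) → ≢x refl))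
    colour′ : Fin n → ℕ
    colour′ w with other? w
    ... | yes _ = R.colour w
    ... | no  _ = R.size
    colour′< : ∀ w → colour′ w < suc R.size
    colour′< w with other? w
    ... | yes o = ℕₚ.m<n⇒m<1+n (R.colour< o)
    ... | no  _ = ℕₚ.≤-refl
    is-x-or-y : ∀ {w} → ¬ (w ≢ x × w ≢ y) → w ≡ x ⊎ w ≡ y
    is-x-or-y {w} ¬o with w ≟ x | w ≟ y
    ... | yes e | _     = inj₁ e
    ... | no _  | yes e = inj₂ e
    ... | no p  | no q  = contradiction (p , q) ¬o
    independent : ∀ {u w} → u ≡ x ⊎ u ≡ y → w ≡ x ⊎ w ≡ y → ¬ Edge G u w
    independent (inj₁ refl) (inj₁ refl) uw = edge⇒≢ G uw refl
    independent (inj₂ refl) (inj₂ refl) uw = edge⇒≢ G uw refl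
    independent (inj₁ refl) (inj₂ refl) uw = contradiction (trans (≡.sym uw) ¬xy) λ ()
    independent (inj₂ refl) (inj₁ refl) uw = contradiction (trans (≡.sym (edge-sym G uw)) ¬xy) λ ()
    proper′ : ∀ {u w} → Edge G u w → colour′ u ≢ colour′ w
    proper′ {u} {w} uw with other? u | other? w
    ... | yes o | yes o′ = R.proper o o′ uw
    ... | yes o | no _   = ℕₚ.<⇒≢ (R.colour< o)
    ... | no _  | yes o  = ≢-sym (ℕₚ.<⇒≢ (R.colour< o))
    ... | no ¬o | no ¬o′ = λ _ → independent (is-x-or-y ¬o) (is-x-or-y ¬o′) uw
  tight-near-uniform false {x} {y} x≢y xy rest = result
    where
    module R = Tight (proper-part (λ w → ¬? (w ≟ x)) {x} (λ ≢ → ≢ refl))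
    fresh : ℕ → ℕ
    fresh zero    = 1
    fresh (suc _) = 0
    fresh-≢ : ∀ c → c ≢ fresh c
    fresh-≢ zero    ()
    fresh-≢ (suc _) ()
    fresh<2 : ∀ c → fresh c < 2
    fresh<2 zero    = s≤s (s≤s z≤n)
    fresh<2 (suc _) = s≤s z≤n
    colour′ : Fin n → ℕ
    colour′ w with w ≟ x
    ... | yes _ = fresh (R.colour y)
    ... | no  _ = R.colour w
    neighbour : ∀ {w} → w ≢ x → Edge G x w → w ≡ y
    neighbour {w} w≢x xw = decidable-stable (w ≟ y) λ w≢y →
      contradiction (trans (≡.sym xw) (rest w w≢x w≢y)) λ ()
    proper′ : ∀ {u w} → Edge G u w → colour′ u ≢ colour′ w
    proper′ {u} {w} uw with u ≟ x | w ≟ x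
    ... | yes refl | yes refl = λ _ → edge⇒≢ G uw refl
    ... | yes refl | no w≢x with refl ← neighbour w≢x uw = ≢-sym (fresh-≢ _)
    ... | no u≢x | yes refl with refl ← neighbour u≢x (edge-sym G uw) = fresh-≢ _
    proper′ {u} {w} uw | no u≢x | no w≢x = R.proper u≢x w≢x uw
    colour′< : ∀ {b} → R.size ≤ b → 2 ≤ b → ∀ w → colour′ w < b
    colour′< s≤b 2≤b w with w ≟ x
    ... | yes _  = ℕₚ.<-≤-trans (fresh<2 _) 2≤b
    ... | no w≢x = ℕₚ.<-≤-trans (R.colour< w≢x) s≤b
    result : Tight G Whole
    result with 2 ℕ.≤? R.size
    ... | yes 2≤k = record
      { size = R.size ; clique = R.clique ; clique-injective = R.clique-injective
      ; clique-in = λ _ → tt ; clique-adj = R.clique-adj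
      ; colour = colour′ ; colour< = λ {w} _ → colour′< ℕₚ.≤-refl 2≤k w ; proper = λ _ _ → proper′
      }
    -- The rest needs at most one colour, so the edge from `x` to `y` is itself a maximum clique.
    ... | no 2≰k = record
      { size = 2 ; clique = cons x (λ _ → y)
      ; clique-injective = cons-injective (λ _ → ≢-sym x≢y) λ { F.zero F.zero _ → refl }
      ; clique-in = λ _ → tt
      ; clique-adj = cons-adj G (λ _ → xy) λ { F.zero F.zero i≢i → contradiction refl i≢i }
      ; colour = colour′ ; colour< = λ {w} _ → colour′< (ℕₚ.<⇒≤ (ℕₚ.≰⇒> 2≰k)) ℕₚ.≤-refl w
      ; proper = λ _ _ → proper′
      }

  tight-reducible : Reducible G → Tight G Whole
  tight-reducible (homogeneous M? x≢x′ Mx Mx′ ¬Ms same) =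
    tight-homogeneous M? x≢x′ Mx Mx′ ¬Ms same
  tight-reducible (near-uniform ρ x≢y xy rest) = tight-near-uniform ρ x≢y xy rest

transport : (G : Graph n) {S : Fin n → Set} (S? : Decidable S) →
  let open Enumeration (enumerate (does ∘ S?)) in
  Tight (induced G elem) (λ _ → ⊤) → Tight G S
transport {n} G {S} S? T = record
  { size = T.size
  ; clique = elem ∘ T.clique
  ; clique-injective = λ i j e → T.clique-injective i j (distinct _ _ e)
  ; clique-in = λ i → does⇒ (S? _) (sound _)
  ; clique-adj = T.clique-adj
  ; colour = colour′
  ; colour< = colour′<
  ; proper = proper′
  }
  where
  open Enumeration (enumerate (does ∘ S?))
  module T = Tight T
  index : ∀ {x} → S x → ∃[ i ] elem i ≡ x
  index Sx = complete (dec-true (S? _) Sx)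
  colour′ : Fin n → ℕ
  colour′ x with S? x
  ... | yes Sx = T.colour (proj₁ (index Sx))
  ... | no _   = 0
  colour′< : ∀ {x} → S x → colour′ x < T.size
  colour′< {x} Sx with S? x
  ... | yes Sx′ = T.colour< tt
  ... | no ¬Sx  = contradiction Sx ¬Sx
  proper′ : ∀ {x y} → S x → S y → Edge G x y → colour′ x ≢ colour′ y
  proper′ {x} {y} Sx Sy xy with S? x | S? y
  ... | no ¬Sx | _ = contradiction Sx ¬Sx
  ... | yes _  | no ¬Sy = contradiction Sy ¬Sy
  ... | yes p  | yes q with index p | index q
  ...   | i , refl | j , refl = T.proper tt tt xy

-- Induction on the number of vertices: proper parts are smaller and inherit the hypothesis, and a
-- reduction of the whole graph assembles their certificates. Graphs with fewer than two vertices
-- are treated directly.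
tight : (G : Graph n) → HereditarilyReducible G → Tight G (λ _ → ⊤)
tight {n} G red = go G red (<-wellFounded n)
  where
  go : (G : Graph m) → HereditarilyReducible G → Acc _<_ m → Tight G (λ _ → ⊤)
  go {zero} G red _ = record
    { size = 0 ; clique = λ () ; clique-injective = λ () ; clique-in = λ () ; clique-adj = λ ()
    ; colour = λ () ; colour< = λ { {()} } ; proper = λ { {()} } }
  go {suc zero} G red _ = record
    { size = 1 ; clique = λ i → i ; clique-injective = λ _ _ e → e ; clique-in = λ _ → tt
    ; clique-adj = λ { F.zero F.zero i≢i → contradiction refl i≢i }
    ; colour = λ _ → 0 ; colour< = λ _ → s≤s z≤n
    ; proper = λ { {F.zero} {F.zero} _ _ e _ → edge⇒≢ G e refl } }
  go {suc (suc m)} G red (acc rs) =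
    tight-reducible part (red (s≤s (s≤s z≤n)) (λ i → i) (λ _ _ e → e))
    where
    part : {S : Fin _ → Set} → Decidable S → ∀ {s} → ¬ S s → Tight G S
    part S? {s} ¬Ss = transport G S? (go (induced G elem)
        (λ 2≤k f inj → red 2≤k (elem ∘ f) (λ i j e → inj i j (distinct _ _ e)))
        (rs (count-<-size (does ∘ S?) s (dec-false (S? s) ¬Ss))))
      where open Enumeration (enumerate (does ∘ S?))

perfect : (G : Graph n) → HereditarilyReducible G → Perfect G
perfect G red m f f-inj = T.size ,
  (((λ x → fromℕ< (T.colour< {x} tt)) ,
    λ x y xy e → T.proper tt tt xy (fromℕ<-injective _ _ _ _ e)) ,
   (λ j (c , c-proper) → clique≤colours T.clique T.clique-adj c c-proper)) ,
  ((T.clique , T.clique-injective , T.clique-adj) ,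
   (λ j (g , _ , g-adj) → colours-injective⇒≤ {c = T.colour} {f = g} (λ _ → T.colour< tt)
      λ i j i≢j → T.proper tt tt (g-adj i j i≢j)))
  where
  H = induced G f
  module T = Tight (tight H λ 2≤k g g-inj → red 2≤k (f ∘ g) (λ i j e → g-inj i j (f-inj _ _ e)))
  clique≤colours : ∀ {k j} (g : Fin k → Fin m) → (∀ i j → i ≢ j → Edge H (g i) (g j)) →
                   (c : Fin m → Fin j) → ProperColoring H j c → k ≤ j
  clique≤colours g g-adj c c-proper = injection⇒≤ (c ∘ g) λ i j e →
    decidable-stable (i ≟ j) λ i≢j → c-proper _ _ (g-adj i j i≢j) e

-- Polar graphs

-- Leaf i hangs off the left or right path of a cycle (side i = just _) or below its hybrid
-- (side i = nothing); rank is the depth of its attachment point, lab the label there, and ρ the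
-- label at the top of the cycle.
record Polar (G : Graph n) : Set where
  field
    side : Fin n → Maybe Bool
    rank : Fin n → ℕ
    lab  : Fin n → Bool
    ρ    : Bool
    across : ∀ {b i j} → side i ≡ just b → side j ≡ just (not b) → adj G i j ≡ ρ
    below  : ∀ {b i j} → side i ≡ just b → side j ≡ nothing → adj G i j ≡ lab i
    along  : ∀ {b i j} → side i ≡ just b → side j ≡ just b → rank i < rank j → adj G i j ≡ lab i
    lab-cong : ∀ {b i j} → side i ≡ just b → side j ≡ just b → rank i ≡ rank j → lab i ≡ lab j
    {left right middle} : Fin n
    side-left   : side left ≡ just true
    side-right  : side right ≡ just false
    side-middle : side middle ≡ nothing

data Position (b : Bool) : Maybe Bool → Set where
  same     : Position b (just b)
  opposite : Position b (just (not b))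
  bottom   : Position b nothing

position : ∀ b s → Position b s
position true  (just true)  = same
position true  (just false) = opposite
position false (just true)  = opposite
position false (just false) = same
position b     nothing      = bottom

module _ {G : Graph n} (P : Polar G) where
  open Polar P

  private
    On : Bool → Fin n → Set
    On b i = side i ≡ just b

    on? : ∀ b → Decidable (On b)
    on? b i = Maybe-≡-dec Boolₚ._≟_ (side i) (just b)

    middle≢ : ∀ {b i} → On b i → middle ≢ i
    middle≢ on refl = contradiction (trans (≡.sym on) side-middle) λ ()

    opposite≢ : ∀ {b i j} → On b i → On (not b) j → i ≢ j
    opposite≢ oni onj refl = Boolₚ.not-¬ refl (just-injective (trans (≡.sym oni) onj))

    record Topmost (b : Bool) (Q : Fin n → Set) : Set where
      field
        vertex : Fin n
        on     : On b vertex
        holds  : Q vertex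
        first  : ∀ {j} → On b j → Q j → rank vertex ≤ rank j

    topmost : ∀ {b Q i} → Decidable Q → On b i → Q i → Topmost b Q
    topmost {b} {Q} Q? oni Qi = go oni Qi (<-wellFounded _)
      where
      go : ∀ {i} → On b i → Q i → Acc _<_ (rank i) → Topmost b Q
      go {i} oni Qi (acc rs) with any? (λ j → on? b j ×-dec Q? j ×-dec (rank j ℕ.<? rank i))
      ... | yes (j , onj , Qj , j<i) = go onj Qj (rs j<i)
      ... | no none = record { vertex = i ; on = oni ; holds = Qi
                             ; first = λ {j} onj Qj → ℕₚ.≮⇒≥ λ j<i → none (j , onj , Qj , j<i) }

    -- All leaves attached at the same depth of a path have the same label and the same position
    -- relative to any other leaf, hence the same adjacency to it; `middle` lies outside.
    tie : ∀ {b i j} → i ≢ j → On b i → On b j → rank i ≡ rank j → Reducible G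
    tie {b} {i} i≢j oni onj i~j =
      homogeneous (λ l → on? b l ×-dec (rank l ℕ.≟ rank i)) i≢j (oni , refl) (onj , ≡.sym i~j)
        (λ (on , _) → middle≢ on refl) uniform
      where
      uniform : ∀ {u u′ y} → On b u × rank u ≡ rank i → On b u′ × rank u′ ≡ rank i →
                ¬ (On b y × rank y ≡ rank i) → adj G u y ≡ adj G u′ y
      uniform {u} {u′} {y} (onu , u~i) (onu′ , u′~i) y∉ with side y in eq | position b (side y)
      ... | _ | opposite = trans (across onu eq) (≡.sym (across onu′ eq))
      ... | _ | bottom = trans (below onu eq) (trans (lab-cong onu onu′ (trans u~i (≡.sym u′~i)))
                           (≡.sym (below onu′ eq)))
      ... | _ | same with ℕₚ.<-cmp (rank y) (rank i)
      ...   | tri≈ _ y~i _ = contradiction (refl , y~i) y∉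
      ...   | tri< y<i _ _ = trans (up u~i onu) (≡.sym (up u′~i onu′))
        where
        up : ∀ {z} → rank z ≡ rank i → On b z → adj G z y ≡ lab y
        up z~i onz = trans (Graph.sym G _ _) (along eq onz (subst (rank y <_) (≡.sym z~i) y<i))
      ...   | tri> _ _ i<y = trans (along onu eq (subst (_< rank y) (≡.sym u~i) i<y))
                               (trans (lab-cong onu onu′ (trans u~i (≡.sym u′~i)))
                                 (≡.sym (along onu′ eq (subst (_< rank y) (≡.sym u′~i) i<y))))

  module Tieless (no-tie : ∀ {b i j} → On b i → On b j → rank i ≡ rank j → i ≡ j) where

    first-adj : ∀ {b Q} (T : Topmost b Q) → let t = Topmost.vertex T in
                ∀ {j} → On b j → Q j → j ≢ t → adj G t j ≡ lab t
    first-adj T onj Qj j≢t = along on onj (ℕₚ.≤∧≢⇒< (first onj Qj) λ t~j → j≢t (≡.sym (no-tie on onj t~j)))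
      where open Topmost T

    module First (b : Bool) {i} (oni : On b i) where
      T : Topmost b (λ _ → ⊤)
      T = topmost (λ _ → yes tt) oni tt

      open Topmost T public using (on) renaming (vertex to t)

      t-adj : ∀ {j} → On b j → j ≢ t → adj G t j ≡ lab t
      t-adj onj = first-adj T onj tt

      -- The topmost leaf sees the opposite path with `ρ` and everything else with its own label, so
      -- agreement of the two makes its adjacency constant.
      agrees : lab t ≡ ρ → Reducible G
      agrees lab≡ρ = uniform-split G (_≟ t) ρ refl (middle≢ on) cross
        where
        cross : ∀ {u y} → u ≡ t → y ≢ t → adj G u y ≡ ρ
        cross {y = y} refl y≢t with side y in eq | position b (side y)
        ... | _ | same     = trans (t-adj eq y≢t) lab≡ρ
        ... | _ | opposite = across on eq
        ... | _ | bottom   = trans (below on eq) lab≡ρ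

      -- The second leaf `t₂` sees the opposite path with `ρ` and all else except `t` with its own
      -- label. If that label is `ρ`, only `t` is exceptional; otherwise it equals the label of `t`,
      -- and the two are twins.
      second : lab t ≡ not ρ → ∀ {j} → On b j → j ≢ t → Reducible G
      second lab≡ {j} onj j≢t = split (lab t₂ Boolₚ.≟ ρ)
        where
        T₂ : Topmost b (_≢ t)
        T₂ = topmost (λ j → ¬? (j ≟ t)) onj j≢t
        open Topmost T₂ using () renaming (vertex to t₂; on to on₂; holds to t₂≢t)
        split : Dec (lab t₂ ≡ ρ) → Reducible G
        split (yes lab₂≡ρ) = near-uniform ρ t₂≢t
            (trans (Graph.sym G _ _) (trans (t-adj on₂ t₂≢t) lab≡)) rest
          where
          rest : ∀ w → w ≢ t₂ → w ≢ t → adj G t₂ w ≡ ρ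
          rest w w≢t₂ w≢t with side w in eq | position b (side w)
          ... | _ | same     = trans (first-adj T₂ eq w≢t w≢t₂) lab₂≡ρ
          ... | _ | opposite = across on₂ eq
          ... | _ | bottom   = trans (below on₂ eq) lab₂≡ρ
        split (no lab₂≢ρ) = twins G (≢-sym t₂≢t) (middle≢ on) (middle≢ on₂) agree
          where
          lab₁≡lab₂ : lab t ≡ lab t₂
          lab₁≡lab₂ = trans lab≡ (≡.sym (Boolₚ.¬-not lab₂≢ρ))
          agree : ∀ w → w ≢ t → w ≢ t₂ → adj G t w ≡ adj G t₂ w
          agree w w≢t w≢t₂ with side w in eq | position b (side w)
          ... | _ | same     = trans (t-adj eq w≢t) (trans lab₁≡lab₂ (≡.sym (first-adj T₂ eq w≢t w≢t₂)))
          ... | _ | opposite = trans (across on eq) (≡.sym (across on₂ eq))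
          ... | _ | bottom   = trans (below on eq) (trans lab₁≡lab₂ (≡.sym (below on₂ eq)))

    module L = First true side-left
    module R = First false side-right

    reducible : Reducible G
    reducible with lab L.t Boolₚ.≟ ρ | lab R.t Boolₚ.≟ ρ
                 | any? (λ j → on? true j ×-dec ¬? (j ≟ L.t)) | any? (λ j → on? false j ×-dec ¬? (j ≟ R.t))
    ... | yes l≡ρ | _ | _ | _ = L.agrees l≡ρ
    ... | no _ | yes r≡ρ | _ | _ = R.agrees r≡ρ
    ... | no l≢ρ | no _ | yes (j , onj , j≢) | _ = L.second (Boolₚ.¬-not l≢ρ) onj j≢
    ... | no _ | no r≢ρ | no _ | yes (j , onj , j≢) = R.second (Boolₚ.¬-not r≢ρ) onj j≢
    -- Each path carries a single leaf and both labels are `not ρ`, so every remaining leaf lies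
    -- below the hybrid and sees the two alike.
    ... | no l≢ρ | no r≢ρ | no l-only | no r-only =
      twins G (opposite≢ L.on R.on) (middle≢ L.on) (middle≢ R.on) agree
      where
      agree : ∀ w → w ≢ L.t → w ≢ R.t → adj G L.t w ≡ adj G R.t w
      agree w w≢l w≢r with side w in eq
      ... | just true  = contradiction (w , eq , w≢l) l-only
      ... | just false = contradiction (w , eq , w≢r) r-only
      ... | nothing    = trans (below L.on eq) (trans (Boolₚ.¬-not l≢ρ)
                           (trans (≡.sym (Boolₚ.¬-not r≢ρ)) (≡.sym (below R.on eq))))

  polar-reducible : Reducible G
  polar-reducible
    with any? (λ i → any? λ j → ¬? (i ≟ j) ×-dec tied? true i j) | any? (λ i → any? λ j → ¬? (i ≟ j) ×-dec tied? false i j)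
    where
    tied? : ∀ b i j → Dec (On b i × On b j × rank i ≡ rank j)
    tied? b i j = on? b i ×-dec on? b j ×-dec (rank i ℕ.≟ rank j)
  ... | yes (i , j , i≢j , oni , onj , i~j) | _ = tie i≢j oni onj i~j
  ... | no _ | yes (i , j , i≢j , oni , onj , i~j) = tie i≢j oni onj i~j
  ... | no none | no none′ = Tieless.reducible no-tie
    where
    no-tie : ∀ {b i j} → On b i → On b j → rank i ≡ rank j → i ≡ j
    no-tie {true} {i} {j} oni onj i~j = decidable-stable (i ≟ j) λ i≢j → none (i , j , i≢j , oni , onj , i~j)
    no-tie {false} {i} {j} oni onj i~j = decidable-stable (i ≟ j) λ i≢j → none′ (i , j , i≢j , oni , onj , i~j)

-- Minimal elements for a well-founded relation

module Extremal {_≺_ : Fin m → Fin m → Set} (≺-wf : WellFounded _≺_) (_≺?_ : ∀ x y → Dec (x ≺ y))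
                {Q : Fin m → Set} (Q? : Decidable Q) where

  -- The invariant `_⊴_` remembers how the result is placed relative to the start; leaving it
  -- abstract lets one search yield both `lowest` and `highest`.
  minimal : ∀ {x} → Q x → (_⊴_ : Fin m → Fin m → Set) → x ⊴ x →
            (∀ {y z} → y ≺ z → z ⊴ x → y ⊴ x) →
            ∃[ y ] y ⊴ x × Q y × (∀ z → z ≺ y → ¬ Q z)
  minimal {x} Qx _⊴_ refl⊴ step = go refl⊴ Qx (≺-wf x)
    where
    go : ∀ {z} → z ⊴ x → Q z → Acc _≺_ z → ∃[ y ] y ⊴ x × Q y × (∀ z → z ≺ y → ¬ Q z)
    go {z} z⊴x Qz (acc rs) with any? (λ y → (y ≺? z) ×-dec Q? y)
    ... | yes (y , y≺z , Qy) = go (step y≺z z⊴x) Qy (rs y≺z)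
    ... | no none = z , z⊴x , Qz , λ y y≺z Qy → none (y , y≺z , Qy)

-- Acyclic digraphs

module Ancestry (a : Arcs m) (acyclic : Acyclic a) where

  infix 4 _≽_ _≻_
  _≽_ _≻_ : Fin m → Fin m → Set
  _≽_ = Ancestor a
  u ≻ v = ∃[ w ] Arc a u w × w ≽ v

  arc? : ∀ u v → Dec (Arc a u v)
  arc? u v = a u v Boolₚ.≟ true

  ≻⇒≽ : ∀ {u v} → u ≻ v → u ≽ v
  ≻⇒≽ (_ , u→w , w≽v) = u→w ◅ w≽v

  ≽⇒≡⊎≻ : ∀ {u v} → u ≽ v → u ≡ v ⊎ u ≻ v
  ≽⇒≡⊎≻ ε = inj₁ refl
  ≽⇒≡⊎≻ (u→w ◅ w≽v) = inj₂ (_ , u→w , w≽v)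

  ≽∧≢⇒≻ : ∀ {u v} → u ≽ v → u ≢ v → u ≻ v
  ≽∧≢⇒≻ u≽v u≢v = [ (λ e → contradiction e u≢v) , (λ p → p) ]′ (≽⇒≡⊎≻ u≽v)

  ≻-≽-trans : ∀ {u v w} → u ≻ v → v ≽ w → u ≻ w
  ≻-≽-trans (x , u→x , x≽v) v≽w = x , u→x , x≽v ◅◅ v≽w

  ≽-≻-trans : ∀ {u v w} → u ≽ v → v ≻ w → u ≻ w
  ≽-≻-trans ε v≻w = v≻w
  ≽-≻-trans (u→x ◅ x≽v) v≻w = _ , u→x , x≽v ◅◅ ≻⇒≽ v≻w

  arc⇒≻ : ∀ {u v} → Arc a u v → u ≻ v
  arc⇒≻ u→v = _ , u→v , ε

  ≻-asym : ∀ {u v} → u ≻ v → ¬ v ≽ u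
  ≻-asym (w , u→w , w≽v) v≽u = acyclic _ w u→w (w≽v ◅◅ v≽u)

  ≽-antisym : ∀ {u v} → u ≽ v → v ≽ u → u ≡ v
  ≽-antisym u≽v v≽u = [ (λ e → e) , (λ u≻v → contradiction v≽u (≻-asym u≻v)) ]′ (≽⇒≡⊎≻ u≽v)

  last-arc : ∀ {u v} → u ≻ v → ∃[ p ] u ≽ p × Arc a p v
  last-arc (_ , u→w , w≽v) = go u→w w≽v
    where
    go : ∀ {u w v} → Arc a u w → w ≽ v → ∃[ p ] u ≽ p × Arc a p v
    go u→v ε = _ , ε , u→v
    go u→w (w→x ◅ x≽v) = let p , w≽p , p→v = go w→x x≽v in p , u→w ◅ w≽p , p→v

  ≻-wf : WellFounded _≻_
  ≻-wf = spo-wellFounded record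
    { isEquivalence = ≡.isEquivalence
    ; irrefl = λ { refl u≻u → ≻-asym u≻u ε }
    ; trans = λ p q → ≻-≽-trans p (≻⇒≽ q)
    ; <-resp-≈ = (λ { refl p → p }) , λ { refl p → p }
    }

  ≺-wf : WellFounded (flip _≻_)
  ≺-wf = spo-noetherian {_⊏_ = _≻_} record
    { isEquivalence = ≡.isEquivalence
    ; irrefl = λ { refl u≻u → ≻-asym u≻u ε }
    ; trans = λ p q → ≻-≽-trans p (≻⇒≽ q)
    ; <-resp-≈ = (λ { refl p → p }) , λ { refl p → p }
    }

  infix 4 _≽?_ _≻?_
  abstract
    _≽?_ : ∀ u v → Dec (u ≽ v)
    u ≽? v = go v (≻-wf v)
      where
      go : ∀ v → Acc _≻_ v → Dec (u ≽ v)
      go v (acc rs) with u ≟ v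
      ... | yes refl = yes ε
      ... | no u≢v = map′ (λ (p , p→v , u≽p) → u≽p ◅◅ (p→v ◅ ε))
                          (λ u≽v → let p , u≽p , p→v = last-arc (≽∧≢⇒≻ u≽v u≢v) in p , p→v , u≽p)
                          (any? through)
        where
        through : ∀ p → Dec (Arc a p v × u ≽ p)
        through p with arc? p v
        ... | no ¬p→v = no (¬p→v ∘ proj₁)
        ... | yes p→v = map′ (p→v ,_) proj₂ (go p (rs (arc⇒≻ p→v)))

  _≻?_ : ∀ u v → Dec (u ≻ v)
  u ≻? v = any? λ w → arc? u w ×-dec (w ≽? v)

  abstract
    lowest : {Q : Fin m → Set} → Decidable Q → ∀ {u} → Q u →
             ∃[ v ] u ≽ v × Q v × (∀ w → v ≻ w → ¬ Q w)
    lowest Q? Qu = Extremal.minimal ≺-wf (flip _≻?_) Q? Qu (flip _≽_) ε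
      λ z≻y u≽z → u≽z ◅◅ ≻⇒≽ z≻y

    highest : {Q : Fin m → Set} → Decidable Q → ∀ {u} → Q u →
              ∃[ v ] v ≽ u × Q v × (∀ w → w ≻ v → ¬ Q w)
    highest Q? Qu = Extremal.minimal ≻-wf _≻?_ Q? Qu _≽_ ε
      λ y≻z z≽u → ≻⇒≽ y≻z ◅◅ z≽u

  root-≽ : ∀ {r} → (∀ r′ → IsRoot a r′ → r′ ≡ r) → ∀ v → r ≽ v
  root-≽ {r} unique v = go v (≻-wf v)
    where
    go : ∀ v → Acc _≻_ v → r ≽ v
    go v (acc rs) with any? (λ p → arc? p v)
    ... | yes (p , p→v) = go p (rs (arc⇒≻ p→v)) ◅◅ (p→v ◅ ε)
    ... | no ¬parent with indeg a v in eq
    ...   | zero = subst (_≽ v) (unique v eq) ε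
    ...   | suc d = contradiction (_ , sound i) ¬parent
      where
      open Enumeration (enumerate (λ u → a u v))
      i = subst Fin (≡.sym eq) F.zero

  -- The hybrids at which a path from elsewhere joins the descendants of `v`.
  Entry : Fin m → Fin m → Set
  Entry v h = (∃[ p ] v ≽ p × Arc a p h) × (∃[ q ] Arc a q h × ¬ v ≽ q)

  Entry⇒≻ : ∀ {v h} → Entry v h → v ≻ h
  Entry⇒≻ ((p , v≽p , p→h) , _) = ≽-≻-trans v≽p (arc⇒≻ p→h)

  -- On a path from `w` to `x`, the first vertex below `v` has its predecessor outside; it is not
  -- `v` itself, since `w` is not above `v`.
  entry : ∀ {v w x} → v ≽ x → w ≽ x → ¬ v ≽ w → ¬ w ≽ v →
          ∃[ h ] (∃[ p ] v ≽ p × Arc a p h) × (∃[ q ] Arc a q h × ¬ v ≽ q × w ≽ q) × h ≽ x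
  entry v≽x ε v⋡w w⋡v = contradiction v≽x v⋡w
  entry {v} {w} v≽x (_◅_ {j = w₁} w→w₁ w₁≽x) v⋡w w⋡v with v ≽? w₁
  ... | yes v≽w₁ = w₁ , last-arc (≽∧≢⇒≻ v≽w₁ λ { refl → w⋡v (w→w₁ ◅ ε) }) , (w , w→w₁ , v⋡w , ε) , w₁≽x
  ... | no v⋡w₁ with entry v≽x w₁≽x v⋡w₁ (λ w₁≽v → w⋡v (w→w₁ ◅ w₁≽v))
  ...   | h , p , (q , q→h , v⋡q , w₁≽q) , h≽x = h , p , (q , q→h , v⋡q , w→w₁ ◅ w₁≽q) , h≽x

  -- Biconnected sets

  Link : (Fin m → Bool) → Fin m → Fin m → Fin m → Set
  Link S w x y = (Mem S x × x ≢ w) × (Mem S y × y ≢ w) × UAdj a x y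

  Link-sym : ∀ {S w x y} → Link S w x y → Link S w y x
  Link-sym (px , py , inj₁ e) = py , px , inj₂ e
  Link-sym (px , py , inj₂ e) = py , px , inj₁ e

  -- Links are symmetric, so connectedness after deleting `w` follows once every remaining vertex
  -- reaches one vertex `e`, which may depend on `w`.
  Hub : (Fin m → Bool) → Fin m → Fin m → Set
  Hub S w e = ∀ x → Mem S x → x ≢ w → Star (Link S w) x e

  hubs⇒biconnected : ∀ {S} → (∀ w → ∃[ e ] Hub S w e) → Biconnected a S
  hubs⇒biconnected hubs w u v Su Sv u≢w v≢w = (Su , u≢w) , (Sv , v≢w) ,
    hub u Su u≢w ◅◅ Star.reverse Link-sym (hub v Sv v≢w)
    where hub = proj₂ (hubs w)

  _∪_ : (Fin m → Bool) → (Fin m → Bool) → Fin m → Bool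
  (S ∪ T) x = S x ∨ T x

  ∪-left : ∀ S T x → Mem S x → Mem (S ∪ T) x
  ∪-left S T x Sx rewrite Sx = refl

  ∪-right : ∀ S T x → Mem T x → Mem (S ∪ T) x
  ∪-right S T x Tx rewrite Tx = Boolₚ.∨-zeroʳ (S x)

  ∪-either : ∀ S T x → Mem (S ∪ T) x → Mem S x ⊎ Mem T x
  ∪-either S T x STx with S x
  ... | true = inj₁ refl
  ... | false = inj₂ STx

  -- Deleting one vertex leaves `s` or `t`, and the survivor connects both sets.
  biconnected-∪ : ∀ {S T s t} → Biconnected a S → Biconnected a T → s ≢ t →
                  Mem S s → Mem S t → Mem T s → Mem T t → Biconnected a (S ∪ T)
  biconnected-∪ {S} {T} {s} {t} bS bT s≢t Ss St Ts Tt = hubs⇒biconnected hubs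
    where
    widen : ∀ {R w x y} → (∀ x → Mem R x → Mem (S ∪ T) x) → Link R w x y → Link (S ∪ T) w x y
    widen R⊆ ((Rx , x≢) , (Ry , y≢) , e) = (R⊆ _ Rx , x≢) , (R⊆ _ Ry , y≢) , e
    hub : ∀ {w e} → e ≢ w → Mem S e → Mem T e → Hub (S ∪ T) w e
    hub {w} {e} e≢w Se Te x STx x≢w with ∪-either S T x STx
    ... | inj₁ Sx = Star.map (widen (∪-left S T)) (proj₂ (proj₂ (bS w x e Sx Se x≢w e≢w)))
    ... | inj₂ Tx = Star.map (widen (∪-right S T)) (proj₂ (proj₂ (bT w x e Tx Te x≢w e≢w)))
    hubs : ∀ w → ∃[ e ] Hub (S ∪ T) w e
    hubs w with s ≟ w
    ... | no s≢w = s , hub s≢w Ss Ts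
    ... | yes refl = t , hub (≢-sym s≢t) St Tt

  between? : ∀ u s x → Dec (u ≽ x × x ≽ s)
  between? u s x = (u ≽? x) ×-dec (x ≽? s)

  interval : Fin m → Fin m → Fin m → Bool
  interval u s x = does (between? u s x)

  interval-in : ∀ {u s x} → u ≽ x → x ≽ s → Mem (interval u s) x
  interval-in u≽x x≽s = dec-true (between? _ _ _) (u≽x , x≽s)

  interval-out : ∀ {u s x} → Mem (interval u s) x → u ≽ x × x ≽ s
  interval-out = does⇒ (between? _ _ _)

  walk : ∀ {u s w x y} → x ≽ y → u ≽ x → y ≽ s → (∀ z → x ≽ z → z ≽ y → z ≢ w) →
         Star (Link (interval u s) w) x y
  walk ε u≽x y≽s avoid = ε
  walk (x→x₁ ◅ x₁≽y) u≽x y≽s avoid =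
    ((interval-in u≽x (x→x₁ ◅ x₁≽y ◅◅ y≽s) , avoid _ ε (x→x₁ ◅ x₁≽y)) ,
     (interval-in u≽x₁ (x₁≽y ◅◅ y≽s) , avoid _ (x→x₁ ◅ ε) x₁≽y) , inj₁ x→x₁)
    ◅ walk x₁≽y u≽x₁ y≽s λ z x₁≽z → avoid z (x→x₁ ◅ x₁≽z)
    where u≽x₁ = u≽x ◅◅ (x→x₁ ◅ ε)

  -- The hypotheses on the arc y → y′ place it on a path from u to s that avoids w.
  interval-biconnected : ∀ {u s} →
    (∀ w → u ≻ w → w ≻ s → ∃[ y ] ∃[ y′ ] u ≽ y × Arc a y y′ × y′ ≽ s × ¬ w ≽ y × ¬ y′ ≽ w) →
    Biconnected a (interval u s)
  interval-biconnected {u} {s} bypass = hubs⇒biconnected hubs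
    where
    up : ∀ {w x} → u ≽ x → x ≽ s → ¬ w ≽ x ⊎ ¬ u ≽ w → Star (Link (interval u s) w) x u
    up u≽x x≽s off = Star.reverse Link-sym (walk u≽x ε x≽s λ where
      z u≽z z≽x refl → [ (λ w⋡x → w⋡x z≽x) , (λ u⋡w → u⋡w u≽z) ]′ off)
    hubs : ∀ w → ∃[ e ] Hub (interval u s) w e
    hubs w with w ≟ u
    ... | yes refl = s , λ x Sx x≢w → let u≽x , x≽s = interval-out Sx in
      walk x≽s u≽x ε λ { z x≽z z≽s refl → x≢w (≽-antisym x≽z u≽x) }
    ... | no w≢u = u , hub
      where
      hub : Hub (interval u s) w u
      hub x Sx x≢w with interval-out Sx
      ... | u≽x , x≽s with w ≽? x | u ≽? w
      ...   | no w⋡x  | _ = up u≽x x≽s (inj₁ w⋡x)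
      ...   | yes w≽x | no u⋡w = up u≽x x≽s (inj₂ u⋡w)
      ...   | yes w≽x | yes u≽w with bypass w (≽∧≢⇒≻ u≽w (≢-sym w≢u)) (≻-≽-trans (≽∧≢⇒≻ w≽x (≢-sym x≢w)) x≽s)
      ...     | y , y′ , u≽y , y→y′ , y′≽s , w⋡y , y′⋡w =
        -- The detour around `w` descends from `x` to `s`, climbs to `y′`, crosses the bypass arc to
        -- `y` and climbs to `u`.
        walk x≽s u≽x ε (λ { z x≽z z≽s refl → x≢w (≽-antisym x≽z w≽x) }) ◅◅
        Star.reverse Link-sym (walk y′≽s (u≽y ◅◅ (y→y′ ◅ ε)) ε λ { z y′≽z z≽s refl → y′⋡w y′≽z }) ◅◅
        ((interval-in (u≽y ◅◅ (y→y′ ◅ ε)) y′≽s , λ { refl → y′⋡w ε }) ,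
         (interval-in u≽y (y→y′ ◅ y′≽s) , λ { refl → w⋡y ε }) , inj₂ y→y′) ◅
        up u≽y (y→y′ ◅ y′≽s) (inj₁ w⋡y)

-- Galled-trees

module Galled (a : Arcs m) (acyclic : Acyclic a) (r : Fin m) (r-unique : ∀ r′ → IsRoot a r′ → r′ ≡ r)
              (indeg≤2 : ∀ v → indeg a v ≤ 2)
              (N4 : ∀ C → IsBlock a C → ∀ h h′ → HybridIn a C h → HybridIn a C h′ → h ≡ h′) where

  open Ancestry a acyclic

  r≽ : ∀ v → r ≽ v
  r≽ = root-≽ r-unique

  three-parents : ∀ {v p q w} → Arc a p v → Arc a q v → Arc a w v → p ≢ q → p ≢ w → q ≢ w → ⊥
  three-parents {v} p→v q→v w→v p≢q p≢w q≢w =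
    ℕₚ.<⇒≱ (3≤count (λ u → a u v) p→v q→v w→v p≢q p≢w q≢w) (indeg≤2 v)

  hybridIn : ∀ {C h p q} → Arc a p h → Arc a q h → p ≢ q → Mem C p → Mem C q → HybridIn a C h
  hybridIn {C} {h} {p} {q} p→h q→h p≢q Cp Cq =
    ℕₚ.≤-antisym (indeg≤2 h) (2≤count (λ u → a u h) p→h q→h p≢q) , parent-in
    where
    parent-in : ∀ u → Arc a u h → Mem C u
    parent-in u u→h with p ≟ u | q ≟ u
    ... | yes refl | _ = Cp
    ... | no _ | yes refl = Cq
    ... | no p≢u | no q≢u = ⊥-elim (three-parents p→h q→h u→h p≢q p≢u q≢u)

  hybridIn-⊆ : ∀ {C D h} → (∀ x → Mem C x → Mem D x) → HybridIn a C h → HybridIn a D h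
  hybridIn-⊆ C⊆D (deg , in-C) = deg , λ u u→h → C⊆D u (in-C u u→h)

  -- N4 speaks of blocks only; a biconnected set is enlarged until it is one.
  one-hybrid : ∀ C {h h′} → Biconnected a C → HybridIn a C h → HybridIn a C h′ → h ≡ h′
  one-hybrid C {h} {h′} bC Ch Ch′ = decidable-stable (h ≟ h′) λ h≢h′ → go h≢h′ C bC Ch Ch′ (<-wellFounded _)
    where
    go : h ≢ h′ → ∀ C → Biconnected a C → HybridIn a C h → HybridIn a C h′ →
         ¬ Acc _<_ (count (not ∘ C))
    go h≢h′ C bC Ch Ch′ (acc rs) = h≢h′ (N4 C (bC , maximal) h h′ Ch Ch′)
      where
      maximal : ∀ D → (∀ x → Mem C x → Mem D x) → Biconnected a D → ∀ x → Mem D x → Mem C x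
      maximal D C⊆D bD x Dx with C x in eq
      ... | true  = refl
      -- `D` would contain both hybrids with fewer vertices outside, which the recursion excludes.
      ... | false = ⊥-elim (go h≢h′ D bD (hybridIn-⊆ C⊆D Ch) (hybridIn-⊆ C⊆D Ch′)
          (rs (count-strict (not ∘ D) (not ∘ C) ¬D⊆¬C x (cong not Dx) (cong not eq))))
        where
        ¬D⊆¬C : ∀ y → not (D y) ≡ true → not (C y) ≡ true
        ¬D⊆¬C y ¬Dy with C y in Cy
        ... | false = refl
        ... | true = contradiction (trans (≡.sym ¬Dy) (cong not (C⊆D y Cy))) λ ()

  -- Stands for a cycle through `v` that closes at `h`. A parent of `v` is recorded because `v` and
  -- this parent are the two vertices in which rings are made to overlap.
  record Ring (v h : Fin m) : Set where
    field
      set : Fin m → Bool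
      biconnected : Biconnected a set
      v-in : Mem set v
      h-in : Mem set h
      h-hybrid : HybridIn a set h
      {above} : Fin m
      above→v : Arc a above v
      above-in : Mem set above

  -- Below the lowest common ancestor u of v and of the parent q outside v, every vertex is bypassed
  -- either by the arc q → h or by a path through v.
  ring : ∀ {v h} → Entry v h → Ring v h
  ring {v} {h} v-enters@((p , v≽p , p→h) , (q , q→h , v⋡q))
    with lowest {λ u → u ≽ v × u ≽ q} (λ u → (u ≽? v) ×-dec (u ≽? q)) (r≽ v , r≽ q)
  ... | u , _ , (u≽v , u≽q) , u-lowest = record
    { set = interval u h
    ; biconnected = interval-biconnected bypass
    ; v-in = interval-in u≽v v≽h
    ; h-in = interval-in (u≽v ◅◅ v≽h) ε
    ; h-hybrid = hybridIn p→h q→h (λ { refl → v⋡q v≽p })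
                   (interval-in (u≽v ◅◅ v≽p) (p→h ◅ ε)) (interval-in u≽q (q→h ◅ ε))
    ; above→v = proj₂ (proj₂ above)
    ; above-in = interval-in (proj₁ (proj₂ above)) (proj₂ (proj₂ above) ◅ v≽h)
    }
    where
    v≻h = Entry⇒≻ v-enters
    v≽h = ≻⇒≽ v≻h
    above = last-arc (≽∧≢⇒≻ u≽v λ { refl → v⋡q u≽q })
    bypass : ∀ w → u ≻ w → w ≻ h → ∃[ y ] ∃[ y′ ] u ≽ y × Arc a y y′ × y′ ≽ h × ¬ w ≽ y × ¬ y′ ≽ w
    bypass w u≻w w≻h with w ≽? q
    ... | no w⋡q = q , h , u≽q , q→h , ε , w⋡q , ≻-asym w≻h
    ... | yes w≽q = let c , v→c , c≽h = v≻h in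
      v , c , u≽v , v→c , c≽h , (λ w≽v → u-lowest w u≻w (w≽v , w≽q)) ,
      λ c≽w → v⋡q (v→c ◅ c≽w ◅◅ w≽q)

  -- The union is biconnected and contains all parents of both hybrids.
  rings-meet : ∀ {v v′ h h′ s t} (R : Ring v h) (R′ : Ring v′ h′) → s ≢ t →
    Mem (Ring.set R) s → Mem (Ring.set R) t → Mem (Ring.set R′) s → Mem (Ring.set R′) t → h ≡ h′
  rings-meet R R′ s≢t Rs Rt R′s R′t =
    one-hybrid (R.set ∪ R′.set) (biconnected-∪ R.biconnected R′.biconnected s≢t Rs Rt R′s R′t)
      (hybridIn-⊆ (∪-left R.set R′.set) R.h-hybrid) (hybridIn-⊆ (∪-right R.set R′.set) R′.h-hybrid)
    where
    module R = Ring R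
    module R′ = Ring R′

  arc⇒≢ : ∀ {u v} → Arc a u v → v ≢ u
  arc⇒≢ u→v refl = ≻-asym (arc⇒≻ u→v) ε

  -- Otherwise the ring of v and h and a ring below v would share v and a parent of v, so that
  -- their union would contain the two hybrids v and h.
  hybrid-no-entry : ∀ {v e e′ h} → Arc a e v → Arc a e′ v → e ≢ e′ → ¬ Entry v h
  hybrid-no-entry {v} {e} {e′} {h} e→v e′→v e≢e′ v-enters = ≻-asym (Entry⇒≻ v-enters) (subst (_≽ v) (≡.sym h≡v) ε)
    where
    closes : ∀ {w} → Ring w v → h ≡ v
    closes R = rings-meet R₀ R (arc⇒≢ R₀.above→v) R₀.v-in R₀.above-in R.h-in
                 (proj₂ R.h-hybrid _ R₀.above→v)
      where
      R₀ = ring v-enters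
      module R₀ = Ring R₀
      module R = Ring R
    h≡v : h ≡ v
    -- Of two distinct parents of `v`, one is not above the other, and `v` is an entry of that one.
    h≡v with e ≽? e′
    ... | no e⋡e′ = closes (ring ((e , ε , e→v) , (e′ , e′→v , e⋡e′)))
    ... | yes e≽e′ = closes (ring ((e′ , ε , e′→v) , (e , e→v , λ e′≽e → e≢e′ (≽-antisym e≽e′ e′≽e))))

  -- Both rings contain a parent of `v`. Two different parents are excluded by `hybrid-no-entry`; a
  -- common one makes the rings overlap in two vertices.
  entry-unique : ∀ {v h h′} → Entry v h → Entry v h′ → h ≡ h′
  entry-unique {v} {h} {h′} enters enters′ = compare (ring enters) (ring enters′)
    where
    compare : Ring v h → Ring v h′ → h ≡ h′
    compare R R′ with Ring.above R ≟ Ring.above R′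
    ... | no ≢above = ⊥-elim (hybrid-no-entry (Ring.above→v R) (Ring.above→v R′) ≢above enters)
    ... | yes ≡above = rings-meet R R′ (arc⇒≢ (Ring.above→v R)) (Ring.v-in R) (Ring.above-in R)
                         (Ring.v-in R′) (subst (Mem (Ring.set R′)) (≡.sym ≡above) (Ring.above-in R′))

  -- Lowest common ancestors are least

  MinimalCA : Fin m → Fin m → Fin m → Set
  MinimalCA v x y = v ≽ x × v ≽ y × (∀ w → v ≻ w → w ≽ x → w ≽ y → ⊥)

  -- If `w` and `v` are incomparable, the paths from `w` to `x` and to `y` enter the descendants of
  -- `v`, by `entry-unique` at the same hybrid. This hybrid is then a common ancestor strictly below
  -- `v`.
  minimalCA-least : ∀ {v x y w} → MinimalCA v x y → w ≽ x → w ≽ y → w ≽ v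
  minimalCA-least {v} {x} {y} {w} (v≽x , v≽y , min) w≽x w≽y with w ≽? v | v ≽? w
  ... | yes w≽v | _ = w≽v
  ... | no w⋡v | yes v≽w = ⊥-elim (min w (≽∧≢⇒≻ v≽w λ { refl → w⋡v ε }) w≽x w≽y)
  ... | no w⋡v | no v⋡w with entry v≽x w≽x v⋡w w⋡v | entry v≽y w≽y v⋡w w⋡v
  ...   | h , p , (q , q→h , v⋡q , _) , h≽x | h′ , p′ , (q′ , q′→h′ , v⋡q′ , _) , h′≽y =
    ⊥-elim (min h (Entry⇒≻ enters) h≽x (subst (_≽ y) (entry-unique enters′ enters) h′≽y))
    where
    enters = p , (q , q→h , v⋡q)
    enters′ = p′ , (q′ , q′→h′ , v⋡q′)

  minimalCA⇒IsLCA : ∀ {v x y} → MinimalCA v x y → IsLCA a x y v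
  minimalCA⇒IsLCA (v≽x , v≽y , min) = v≽x , v≽y , λ w w≽x w≽y v≽w →
    [ ≡.sym , (λ v≻w → ⊥-elim (min w v≻w w≽x w≽y)) ]′ (≽⇒≡⊎≻ v≽w)

  IsLCA-unique : ∀ {v x y w} → MinimalCA v x y → IsLCA a x y w → w ≡ v
  IsLCA-unique min@(v≽x , v≽y , _) (w≽x , w≽y , w-min) =
    ≡.sym (w-min _ v≽x v≽y (minimalCA-least min w≽x w≽y))

  -- Siblings with a common descendant

  HighestCD : Fin m → Fin m → Fin m → Set
  HighestCD c d h = c ≽ h × d ≽ h × (∀ w → w ≻ h → c ≽ w → d ≽ w → ⊥)

  highestCD-sym : ∀ {c d h} → HighestCD c d h → HighestCD d c h
  highestCD-sym (c≽h , d≽h , max) = d≽h , c≽h , λ w w≻h d≽w c≽w → max w w≻h c≽w d≽w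

  highestCD : ∀ {c d x} → c ≽ x → d ≽ x → ∃[ h ] h ≽ x × HighestCD c d h
  highestCD {c} {d} c≽x d≽x
    with highest {λ w → c ≽ w × d ≽ w} (λ w → (c ≽? w) ×-dec (d ≽? w)) (c≽x , d≽x)
  ... | h , h≽x , (c≽h , d≽h) , max = h , h≽x , c≽h , d≽h , λ w w≻h c≽w d≽w → max w w≻h (c≽w , d≽w)

  module _ {v c d h : Fin m} (v→c : Arc a v c) (v→d : Arc a v d) (c≢d : c ≢ d) (hcd : HighestCD c d h) where
    private
      c≽h = proj₁ hcd
      d≽h = proj₁ (proj₂ hcd)
      max = proj₂ (proj₂ hcd)

    -- A parent of `h` on the branch of `d` cannot lie below `c`, as `h` is highest; when `h` is `d`
    -- itself, the outside parent is `v`.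
    sibling-entry : h ≢ c → Entry c h
    sibling-entry h≢c = last-arc (≽∧≢⇒≻ c≽h (≢-sym h≢c)) , outside
      where
      outside : ∃[ q ] Arc a q h × ¬ c ≽ q
      outside with d ≟ h
      ... | yes refl = v , v→d , ≻-asym (arc⇒≻ v→c)
      ... | no d≢h = let q , d≽q , q→h = last-arc (≽∧≢⇒≻ d≽h d≢h)
                     in q , q→h , λ c≽q → max q (arc⇒≻ q→h) c≽q d≽q

    -- Besides `v`, `c` then has a parent below `d`, so it is a hybrid.
    sibling-no-entry : h ≡ c → ∀ {h′} → ¬ Entry c h′
    sibling-no-entry refl =
      let q , d≽q , q→c = last-arc (≽∧≢⇒≻ d≽h (≢-sym c≢d))
      in hybrid-no-entry v→c q→c λ { refl → ≻-asym (arc⇒≻ v→d) d≽q }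

  highestCD-unique : ∀ {v c d e h h′} → Arc a v c → Arc a v d → Arc a v e → c ≢ d → c ≢ e →
    HighestCD c d h → HighestCD c e h′ → h ≡ h′
  highestCD-unique {c = c} {h = h} {h′} v→c v→d v→e c≢d c≢e hcd hce with h ≟ c | h′ ≟ c
  ... | yes e | yes e′ = trans e (≡.sym e′)
  ... | yes e | no ≢c = ⊥-elim (sibling-no-entry v→c v→d c≢d hcd e (sibling-entry v→c v→e c≢e hce ≢c))
  ... | no ≢c | yes e = ⊥-elim (sibling-no-entry v→c v→e c≢e hce e (sibling-entry v→c v→d c≢d hcd ≢c))
  ... | no p  | no q = entry-unique (sibling-entry v→c v→d c≢d hcd p) (sibling-entry v→c v→e c≢e hce q)

  -- The parent of h on the branch of v through c, which is v itself when h = c.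
  BranchParent : Fin m → Fin m → Fin m → Fin m → Set
  BranchParent v c h p = Arc a p h × (h ≡ c × p ≡ v ⊎ c ≽ p)

  branchParent : ∀ {v c h} → Arc a v c → c ≽ h → ∃ (BranchParent v c h)
  branchParent {v} v→c c≽h with ≽⇒≡⊎≻ c≽h
  ... | inj₁ refl = v , v→c , inj₁ (refl , refl)
  ... | inj₂ c≻h = let p , c≽p , p→h = last-arc c≻h in p , p→h , inj₂ c≽p

  branchParent-distinct : ∀ {v c d h p q} → Arc a v c → Arc a v d → c ≢ d → HighestCD c d h →
    BranchParent v c h p → BranchParent v d h q → p ≢ q
  branchParent-distinct v→c v→d c≢d hcd (_ , inj₁ (refl , _)) (_ , inj₁ (refl , _)) refl = c≢d refl
  branchParent-distinct v→c v→d c≢d hcd (_ , inj₁ (_ , refl)) (_ , inj₂ d≽v) refl = ≻-asym (arc⇒≻ v→d) d≽v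
  branchParent-distinct v→c v→d c≢d hcd (_ , inj₂ c≽v) (_ , inj₁ (_ , refl)) refl = ≻-asym (arc⇒≻ v→c) c≽v
  branchParent-distinct v→c v→d c≢d (_ , _ , max) (p→h , inj₂ c≽p) (_ , inj₂ d≽p) refl = max _ (arc⇒≻ p→h) c≽p d≽p

  -- By `highestCD-unique` all three pairs of branches meet at one vertex `h`, which would have a
  -- different parent on each branch.
  no-three-siblings : ∀ {v c d e x y} → Arc a v c → Arc a v d → Arc a v e → c ≢ d → c ≢ e → d ≢ e →
    c ≽ x → d ≽ x → c ≽ y → e ≽ y → ⊥
  no-three-siblings {v} {c} {d} {e} v→c v→d v→e c≢d c≢e d≢e c≽x d≽x c≽y e≽y
    with highestCD c≽x d≽x | highestCD c≽y e≽y
  ... | h , _ , hcd@(c≽h , d≽h , _) | h′ , _ , hce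
    with refl ← highestCD-unique v→c v→d v→e c≢d c≢e hcd hce
    with highestCD d≽h (proj₁ (proj₂ hce))
  ... | h″ , _ , hde
    with refl ← highestCD-unique v→d v→c v→e (≢-sym c≢d) d≢e (highestCD-sym hcd) hde
    with branchParent v→c c≽h | branchParent v→d d≽h | branchParent v→e (proj₁ (proj₂ hce))
  ... | p , bp | q , bq | w , bw = three-parents (proj₁ bp) (proj₁ bq) (proj₁ bw)
      (branchParent-distinct v→c v→d c≢d hcd bp bq)
      (branchParent-distinct v→c v→e c≢e hce bp bw)
      (branchParent-distinct v→d v→e d≢e hde bq bw)

  -- Attachment points on the path from c to the hybrid h

  module _ {c h : Fin m} (h-entered : Entry c h) where
    private
      no-entry : ∀ {h′} → ¬ Entry h h′
      no-entry = let (p , c≽p , p→h) , (q , q→h , c⋡q) = h-entered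
                 in hybrid-no-entry p→h q→h λ { refl → c⋡q c≽p }

      c≽h : c ≽ h
      c≽h = ≻⇒≽ (Entry⇒≻ h-entered)

    entry-below : ∀ {u} → c ≽ u → u ≻ h → Entry u h
    entry-below c≽u u≻h = let _ , (q , q→h , c⋡q) = h-entered
                          in last-arc u≻h , (q , q→h , λ u≽q → c⋡q (c≽u ◅◅ u≽q))

    module _ {α x} (c≽x : c ≽ x) (h⋡x : ¬ h ≽ x) (α-mca : MinimalCA α x h) where

      attached-≻ : α ≻ h
      attached-≻ = let α≽x , α≽h , _ = α-mca in ≽∧≢⇒≻ α≽h λ { refl → h⋡x α≽x }

      attached-≼ : c ≽ α
      attached-≼ = minimalCA-least α-mca c≽x c≽h

      -- A common ancestor of `x` and `z` that is not above `h` would enter the descendants of `h`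
      -- from outside, but `h` is a hybrid and has no entries.
      mca-below : ∀ {z} → h ≽ z → MinimalCA α x z
      mca-below {z} h≽z = α≽x , α≽h ◅◅ h≽z , min′
        where
        α≽x = proj₁ α-mca
        α≽h = proj₁ (proj₂ α-mca)
        min = proj₂ (proj₂ α-mca)
        min′ : ∀ w → α ≻ w → w ≽ x → w ≽ z → ⊥
        min′ w α≻w w≽x w≽z with w ≽? h
        ... | yes w≽h = min w α≻w w≽x w≽h
        ... | no w⋡h with entry h≽z w≽z (λ h≽w → h⋡x (h≽w ◅◅ w≽x)) w⋡h
        ...   | _ , p , (q , q→h′ , h⋡q , _) , _ = no-entry (p , (q , q→h′ , h⋡q))

    -- If incomparable, `α` and `β` would reach `h` through different parents, both below `c`; with
    -- the parent of `h` outside `c` these are three.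
    attached-comparable : ∀ {α β x y} → c ≽ x → ¬ h ≽ x → MinimalCA α x h →
      c ≽ y → ¬ h ≽ y → MinimalCA β y h → α ≽ β ⊎ β ≽ α
    attached-comparable {α} {β} c≽x h⋡x α-mca c≽y h⋡y β-mca with α ≽? β | β ≽? α
    ... | yes α≽β | _ = inj₁ α≽β
    ... | no _ | yes β≽α = inj₂ β≽α
    ... | no α⋡β | no β⋡α with entry (≻⇒≽ (attached-≻ c≽x h⋡x α-mca)) (≻⇒≽ (attached-≻ c≽y h⋡y β-mca)) α⋡β β⋡α
    ...   | h′ , (p , α≽p , p→h′) , (q , q→h′ , α⋡q , β≽q) , _
      with refl ← entry-unique ((p , α≽p , p→h′) , (q , q→h′ , α⋡q))
                    (entry-below (attached-≼ c≽x h⋡x α-mca) (attached-≻ c≽x h⋡x α-mca)) =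
      let _ , (o , o→h , c⋡o) = h-entered
          c≽p = attached-≼ c≽x h⋡x α-mca ◅◅ α≽p
          c≽q = attached-≼ c≽y h⋡y β-mca ◅◅ β≽q
      in ⊥-elim (three-parents p→h′ q→h′ o→h (λ { refl → α⋡q α≽p }) (λ { refl → c⋡o c≽p }) (λ { refl → c⋡o c≽q }))

    -- Let `w` be a common ancestor of `x` and `y` strictly below `α`. If it is above `β` or
    -- incomparable to it, it is above `h`, in the latter case because its path to `y` enters the
    -- descendants of `β` at `h`. If it is below `β`, then `β` is above `x`. Each contradicts the
    -- minimality of `α`.
    mca-along : ∀ {α β x y} → c ≽ x → ¬ h ≽ x → MinimalCA α x h →
      c ≽ y → ¬ h ≽ y → MinimalCA β y h → α ≻ β → MinimalCA α x y
    mca-along {α} {β} {x} {y} c≽x h⋡x α-mca@(α≽x , α≽h , min) c≽y h⋡y β-mca@(β≽y , β≽h , _) α≻β =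
      α≽x , ≻⇒≽ α≻β ◅◅ β≽y , min′
      where
      min′ : ∀ w → α ≻ w → w ≽ x → w ≽ y → ⊥
      min′ w α≻w w≽x w≽y with w ≽? β | β ≽? w
      ... | yes w≽β | _ = min w α≻w w≽x (w≽β ◅◅ β≽h)
      ... | no _ | yes β≽w = min β α≻β (β≽w ◅◅ w≽x) β≽h
      ... | no w⋡β | no β⋡w with entry β≽y w≽y β⋡w w⋡β
      ...   | h′ , p , (q , q→h′ , β⋡q , w≽q) , h′≽y
        with refl ← entry-unique (p , (q , q→h′ , β⋡q))
                      (entry-below (attached-≼ c≽y h⋡y β-mca) (attached-≻ c≽y h⋡y β-mca)) =
        min w α≻w w≽x (w≽q ◅◅ (q→h′ ◅ ε))

  -- Counting ancestors gives a number that grows strictly downwards, so it reflects the order of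
  -- the pairwise comparable attachment points on a path.
  depth : Fin m → ℕ
  depth v = count (λ u → does (u ≽? v))

  depth-≻ : ∀ {u v} → u ≻ v → depth u < depth v
  depth-≻ {u} {v} u≻v = count-strict (λ w → does (w ≽? u)) (λ w → does (w ≽? v))
    (λ w w≽u → dec-true (w ≽? v) (does⇒ (w ≽? u) w≽u ◅◅ ≻⇒≽ u≻v))
    v (dec-false (v ≽? u) (≻-asym u≻v)) (dec-true (v ≽? v) ε)

  minimalCA : ∀ x y → ∃[ v ] MinimalCA v x y
  minimalCA x y with lowest {λ w → w ≽ x × w ≽ y} (λ w → (w ≽? x) ×-dec (w ≽? y)) (r≽ x , r≽ y)
  ... | v , _ , (v≽x , v≽y) , min = v , v≽x , v≽y , λ w v≻w w≽x w≽y → min w v≻w (w≽x , w≽y)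

  -- Reducibility of the graph on a set of leaves

  module Explained (H : Graph k) (ψ : Fin k → Fin m) (ψ-injective : Injective ψ)
                   (leaf : ∀ i w → ψ i ≽ w → w ≡ ψ i) (label : Fin m → Bool)
                   (adj-mca : ∀ {v i j} → i ≢ j → MinimalCA v (ψ i) (ψ j) → adj H i j ≡ label v)
                   {i₀ i₁ : Fin k} (i₀≢i₁ : i₀ ≢ i₁) where

    reducible-below : ∀ v → (∀ i → v ≽ ψ i) → (∀ w → v ≻ w → ¬ (∀ i → w ≽ ψ i)) → Reducible H
    reducible-below v v≽ v-lowest
      = decide (any? λ c → any? λ d → any? λ i →
          ¬? (c ≟ d) ×-dec arc? v c ×-dec arc? v d ×-dec (c ≽? ψ i) ×-dec (d ≽? ψ i))
      where
      v≻ : ∀ i → v ≻ ψ i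
      v≻ i = ≽∧≢⇒≻ (v≽ i) v≢
        where
        v≢ : v ≢ ψ i
        v≢ refl = i₀≢i₁ (trans (only i₀) (≡.sym (only i₁)))
          where
          only : ∀ j → j ≡ i
          only j = ψ-injective j i (leaf i (ψ j) (v≽ j))

      missed : ∀ {c} → Arc a v c → ∃[ i ] ¬ c ≽ ψ i
      missed {c} v→c = ¬∀⟶∃¬ k _ (λ i → c ≽? ψ i) (v-lowest c (arc⇒≻ v→c))

      separated : ∀ {i j} → (∀ c → Arc a v c → c ≽ ψ i → c ≽ ψ j → ⊥) → MinimalCA v (ψ i) (ψ j)
      separated {i} {j} sep = v≽ i , v≽ j , λ where
        w (c , v→c , c≽w) w≽i w≽j → sep c v→c (c≽w ◅◅ w≽i) (c≽w ◅◅ w≽j)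

      module Disjoint (disjoint : ∀ {c d i} → Arc a v c → Arc a v d → c ≽ ψ i → d ≽ ψ i → c ≡ d) where

        reducible : Reducible H
        reducible with v≻ i₀
        ... | c , v→c , c≽i₀ = uniform-split H (λ i → c ≽? ψ i) (label v) c≽i₀ (proj₂ (missed v→c)) λ {i} {j} c≽i c⋡j →
          adj-mca (λ { refl → c⋡j c≽i }) (separated λ d v→d d≽i d≽j →
            c⋡j (subst (_≽ ψ j) (disjoint v→d v→c d≽i c≽i) d≽j))

      module Shared {c d z} (c≢d : c ≢ d) (v→c : Arc a v c) (v→d : Arc a v d) (c≽z : c ≽ ψ z) (d≽z : d ≽ ψ z) where

        third-apart : ∀ {e i} → Arc a v e → e ≢ c → e ≢ d → e ≽ ψ i → c ≽ ψ i ⊎ d ≽ ψ i → ⊥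
        third-apart v→e e≢c e≢d e≽i (inj₁ c≽i) =
          no-three-siblings v→c v→d v→e c≢d (≢-sym e≢c) (≢-sym e≢d) c≽z d≽z c≽i e≽i
        third-apart v→e e≢c e≢d e≽i (inj₂ d≽i) =
          no-three-siblings v→d v→c v→e (≢-sym c≢d) (≢-sym e≢d) (≢-sym e≢c) d≽z c≽z d≽i e≽i

        reducible-outside : ∀ {s} → ¬ (c ≽ ψ s ⊎ d ≽ ψ s) → Reducible H
        reducible-outside ∌s = uniform-split H (λ i → (c ≽? ψ i) ⊎-dec (d ≽? ψ i)) (label v) (inj₁ c≽z) ∌s
          λ {i} {j} ∋i ∌j → adj-mca (λ { refl → ∌j ∋i }) (separated λ e v→e e≽i e≽j →
            third-apart v→e (λ { refl → ∌j (inj₁ e≽j) }) (λ { refl → ∌j (inj₂ e≽j) }) e≽i ∋i)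

        module Cycle (covered : ∀ i → c ≽ ψ i ⊎ d ≽ ψ i) where

          h : Fin m
          h = proj₁ (highestCD c≽z d≽z)
          h≽z : h ≽ ψ z
          h≽z = proj₁ (proj₂ (highestCD c≽z d≽z))
          hcd : HighestCD c d h
          hcd = proj₂ (proj₂ (highestCD c≽z d≽z))

          not-c : ∃[ i ] ¬ c ≽ ψ i
          not-c = missed v→c
          not-d : ∃[ i ] ¬ d ≽ ψ i
          not-d = missed v→d

          other-c : ∀ {i} → ¬ d ≽ ψ i → c ≽ ψ i
          other-c {i} d⋡i = [ (λ p → p) , (λ d≽i → contradiction d≽i d⋡i) ]′ (covered i)
          other-d : ∀ {i} → ¬ c ≽ ψ i → d ≽ ψ i
          other-d {i} c⋡i = [ (λ c≽i → contradiction c≽i c⋡i) , (λ p → p) ]′ (covered i)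

          -- Otherwise `c` would be above every leaf of the set, although `v` is lowest.
          c⋡d : ¬ c ≽ d
          c⋡d c≽d = let _ , c⋡i = not-c in c⋡i (c≽d ◅◅ other-d c⋡i)
          d⋡c : ¬ d ≽ c
          d⋡c d≽c = let _ , d⋡i = not-d in d⋡i (d≽c ◅◅ other-c d⋡i)

          -- Any highest common descendant of `c` and `d` is an entry of `c`, and there is only one.
          common⇒h : ∀ {i} → c ≽ ψ i → d ≽ ψ i → h ≽ ψ i
          common⇒h {i} c≽i d≽i with highestCD c≽i d≽i
          ... | h′ , h′≽i , hcd′ = subst (_≽ ψ i) (entry-unique
              (sibling-entry v→c v→d c≢d hcd′ λ { refl → d⋡c (proj₁ (proj₂ hcd′)) })
              (sibling-entry v→c v→d c≢d hcd λ h≡c → d⋡c (subst (d ≽_) h≡c (proj₁ (proj₂ hcd))))) h′≽i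

          branch : Bool → Fin m
          branch true  = c
          branch false = d

          branch-entry : ∀ b → Entry (branch b) h
          branch-entry true = sibling-entry v→c v→d c≢d hcd
            λ h≡c → d⋡c (subst (d ≽_) h≡c (proj₁ (proj₂ hcd)))
          branch-entry false = sibling-entry v→d v→c (≢-sym c≢d) (highestCD-sym hcd)
            λ h≡d → c⋡d (subst (c ≽_) h≡d (proj₁ hcd))

          side : Fin k → Maybe Bool
          side i with h ≽? ψ i | c ≽? ψ i
          ... | yes _ | _     = nothing
          ... | no _  | yes _ = just true
          ... | no _  | no _  = just false

          side-just : ∀ {b i} → side i ≡ just b → branch b ≽ ψ i × ¬ branch (not b) ≽ ψ i × ¬ h ≽ ψ i
          side-just {b} {i} eq with h ≽? ψ i | c ≽? ψ i
          side-just {true}  refl | no h⋡i | yes c≽i = c≽i , (λ d≽i → h⋡i (common⇒h c≽i d≽i)) , h⋡i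
          side-just {false} refl | no h⋡i | no c⋡i  = other-d c⋡i , c⋡i , h⋡i

          side-nothing : ∀ {i} → side i ≡ nothing → h ≽ ψ i
          side-nothing {i} eq with h ≽? ψ i | c ≽? ψ i
          ... | yes h≽i | _ = h≽i
          side-nothing () | no _ | yes _
          side-nothing () | no _ | no _

          -- For a leaf off a path, this is its attachment point, the vertex where the ways to the
          -- leaf and to `h` part.
          α : Fin k → Fin m
          α i = proj₁ (minimalCA (ψ i) h)
          α-mca : ∀ i → MinimalCA (α i) (ψ i) h
          α-mca i = proj₂ (minimalCA (ψ i) h)

          side≢ : ∀ {s t i j} → side i ≡ s → side j ≡ t → s ≢ t → i ≢ j
          side≢ eqi eqj s≢t refl = s≢t (trans (≡.sym eqi) eqj)

          comparable : ∀ {b i j} → side i ≡ just b → side j ≡ just b → α i ≽ α j ⊎ α j ≽ α i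
          comparable {b} {i} {j} si sj = attached-comparable (branch-entry b) (proj₁ pi) (proj₂ (proj₂ pi)) (α-mca i)
                                       (proj₁ pj) (proj₂ (proj₂ pj)) (α-mca j)
            where
            pi = side-just si
            pj = side-just sj

          above : ∀ {b i j} → side i ≡ just b → side j ≡ just b → depth (α i) < depth (α j) → α i ≻ α j
          above si sj i<j with comparable si sj
          ... | inj₁ i≽j = ≽∧≢⇒≻ i≽j λ e → ℕₚ.<⇒≢ i<j (cong depth e)
          ... | inj₂ j≽i = [ (λ e → contradiction (cong depth (≡.sym e)) (ℕₚ.<⇒≢ i<j))
                           , (λ j≻i → contradiction (depth-≻ j≻i) (ℕₚ.<⇒≯ i<j)) ]′ (≽⇒≡⊎≻ j≽i)

          level : ∀ {b i j} → side i ≡ just b → side j ≡ just b → depth (α i) ≡ depth (α j) → α i ≡ α j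
          level si sj i~j with comparable si sj
          ... | inj₁ i≽j = [ (λ e → e) , (λ i≻j → contradiction i~j (ℕₚ.<⇒≢ (depth-≻ i≻j))) ]′ (≽⇒≡⊎≻ i≽j)
          ... | inj₂ j≽i = [ ≡.sym , (λ j≻i → contradiction (≡.sym i~j) (ℕₚ.<⇒≢ (depth-≻ j≻i))) ]′ (≽⇒≡⊎≻ j≽i)

          side-left′ : ∀ {i} → ¬ d ≽ ψ i → side i ≡ just true
          side-left′ {i} d⋡i with h ≽? ψ i | c ≽? ψ i
          ... | yes h≽i | _ = contradiction (proj₁ (proj₂ hcd) ◅◅ h≽i) d⋡i
          ... | no _ | yes _ = refl
          ... | no _ | no c⋡i = contradiction (other-c d⋡i) c⋡i

          side-right′ : ∀ {i} → ¬ c ≽ ψ i → side i ≡ just false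
          side-right′ {i} c⋡i with h ≽? ψ i | c ≽? ψ i
          ... | yes h≽i | _ = contradiction (proj₁ hcd ◅◅ h≽i) c⋡i
          ... | no _ | yes c≽i = contradiction c≽i c⋡i
          ... | no _ | no _ = refl

          side-middle′ : ∀ {i} → h ≽ ψ i → side i ≡ nothing
          side-middle′ {i} h≽i with h ≽? ψ i | c ≽? ψ i
          ... | yes _ | _ = refl
          ... | no h⋡i | _ = contradiction h≽i h⋡i

          across : ∀ b {i j} → side i ≡ just b → side j ≡ just (not b) → adj H i j ≡ label v
          across b {i} {j} si sj with side-just si | side-just sj
          -- Each of `c` and `d` misses one of the two leaves, and a third child of `v` shares no
          -- leaf with either branch.
          ... | b≽i , b̄⋡i , h⋡i | b̄≽j , b⋡j , h⋡j = adj-mca (side≢ si sj λ { e → Boolₚ.not-¬ refl (just-injective e) })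
              (separated (apart b b≽i b̄⋡i b⋡j))
            where
            apart : ∀ b → branch b ≽ ψ i → ¬ branch (not b) ≽ ψ i → ¬ branch (not (not b)) ≽ ψ j →
                    ∀ e → Arc a v e → e ≽ ψ i → e ≽ ψ j → ⊥
            apart true c≽i d⋡i c⋡j e v→e e≽i e≽j =
              third-apart v→e (λ { refl → c⋡j e≽j }) (λ { refl → d⋡i e≽i }) e≽i (inj₁ c≽i)
            apart false d≽i c⋡i d⋡j e v→e e≽i e≽j =
              third-apart v→e (λ { refl → c⋡i e≽i }) (λ { refl → d⋡j e≽j }) e≽i (inj₂ d≽i)

          polar : Polar H
          polar = record
            { side = side
            ; rank = λ i → depth (α i)
            ; lab = λ i → label (α i)
            ; ρ = label v
            ; across = λ {b} → across b
            ; below = λ {b} {i} si sj → let b≽i , _ , h⋡i = side-just si in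
                adj-mca (side≢ si sj λ ()) (mca-below (branch-entry b) b≽i h⋡i (α-mca i) (side-nothing sj))
            ; along = λ {b} {i} {j} si sj i<j → let b≽i , _ , h⋡i = side-just si ; b≽j , _ , h⋡j = side-just sj in
                adj-mca (λ { refl → ℕₚ.<-irrefl refl i<j })
                  (mca-along (branch-entry b) b≽i h⋡i (α-mca i) b≽j h⋡j (α-mca j) (above si sj i<j))
            ; lab-cong = λ si sj i~j → cong label (level si sj i~j)
            ; side-left = side-left′ (proj₂ not-d)
            ; side-right = side-right′ (proj₂ not-c)
            ; side-middle = side-middle′ h≽z
            }

        reducible : Reducible H
        reducible with all? (λ i → (c ≽? ψ i) ⊎-dec (d ≽? ψ i))
        ... | yes covered = polar-reducible (Cycle.polar covered)
        ... | no ¬covered = reducible-outside (proj₂ (¬∀⟶∃¬ k _ (λ i → (c ≽? ψ i) ⊎-dec (d ≽? ψ i)) ¬covered))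

      decide : Dec (∃[ c ] ∃[ d ] ∃[ i ] c ≢ d × Arc a v c × Arc a v d × c ≽ ψ i × d ≽ ψ i) → Reducible H
      decide (yes (c , d , z , c≢d , v→c , v→d , c≽z , d≽z)) = Shared.reducible c≢d v→c v→d c≽z d≽z
      decide (no none) = Disjoint.reducible λ {c} {d} {i} v→c v→d c≽i d≽i →
        decidable-stable (c ≟ d) λ c≢d → none (c , d , i , c≢d , v→c , v→d , c≽i , d≽i)

    reducible : Reducible H
    reducible with lowest {λ w → ∀ i → w ≽ ψ i} (λ w → all? λ i → w ≽? ψ i) (λ i → r≽ (ψ i))
    ... | v , _ , v≽ , v-lowest = reducible-below v v≽ v-lowest

-- From labeled galled-trees to weakly-chordal and perfect graphs

isLab1 : Label → Bool
isLab1 lab1 = true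
isLab1 lab0 = false
isLab1 ⊙    = false

isLab1⇒ : ∀ l → isLab1 l ≡ true → l ≡ lab1
isLab1⇒ lab1 _ = refl

GaTEx⇒hereditarilyReducible : (G : Graph n) → GaTEx G → HereditarilyReducible G
GaTEx⇒hereditarilyReducible G (m , a , t , φ , φ-inj , inj₁ (refl , _) , _) 2≤k f f-inj =
  contradiction (injection⇒≤ (φ ∘ f) λ i j e → f-inj i j (φ-inj _ _ e)) (ℕₚ.<⇒≱ 2≤k)
GaTEx⇒hereditarilyReducible {n} G
  (m , a , t , φ , φ-inj , inj₂ (acyclic , (r , _ , _ , r-unique) , leaves , inner , N4) , _ , explains)
  {suc (suc k)} (s≤s (s≤s z≤n)) f f-inj =
  Explained.reducible (induced G f) (φ ∘ f) (λ i j e → f-inj i j (φ-inj _ _ e))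
    (λ i w → leaf (f i)) (isLab1 ∘ t) (λ i≢j → adj-mca (i≢j ∘ f-inj _ _)) {F.zero} {F.suc F.zero} λ ()
  where
  indeg≤2 : ∀ v → indeg a v ≤ 2
  indeg≤2 v with indeg a v ℕ.≟ 0 | any? (λ x → φ x ≟ v)
  ... | yes deg0 | _ = ℕₚ.≤-trans (ℕₚ.≤-reflexive deg0) z≤n
  ... | no _ | yes X = ℕₚ.≤-trans (ℕₚ.≤-reflexive (proj₂ (proj₁ (leaves v) X))) (s≤s z≤n)
  ... | no ≢0 | no ¬X with inner v ≢0 ¬X
  ...   | inj₁ (deg1 , _) = ℕₚ.≤-trans (ℕₚ.≤-reflexive deg1) (s≤s z≤n)
  ...   | inj₂ (deg2 , _) = ℕₚ.≤-reflexive deg2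

  open Galled a acyclic r r-unique indeg≤2 N4

  leaf : ∀ x {w} → Ancestor a (φ x) w → w ≡ φ x
  leaf x ε = refl
  leaf x (x→w ◅ _) = contradiction (proj₁ (proj₁ (leaves (φ x)) (x , refl)))
    (≢-sym (ℕₚ.<⇒≢ (1≤count (a (φ x)) x→w)))

  -- For a label other than `lab1`, an edge would provide some lowest common ancestor labeled
  -- `lab1`, and by uniqueness it would be `v`.
  adj-mca : ∀ {v x y} → x ≢ y → MinimalCA v (φ x) (φ y) → adj G x y ≡ isLab1 (t v)
  adj-mca {v} {x} {y} x≢y mca with isLab1 (t v) in eq
  ... | true = proj₂ (explains x y x≢y) (v , minimalCA⇒IsLCA mca , isLab1⇒ (t v) eq)
  ... | false = Boolₚ.¬-not λ xy → let w , lca , w-lab1 = proj₁ (explains x y x≢y) xy in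
    contradiction (trans (≡.sym eq) (cong isLab1 (trans (cong t (≡.sym (IsLCA-unique mca lca))) w-lab1))) λ ()

mainTheorem6 : ∀ {n : ℕ} (G : Graph n) → GaTEx G → WeaklyChordal G × Perfect G
mainTheorem6 G gatex = weaklyChordal G reducible , perfect G reducible
  where reducible = GaTEx⇒hereditarilyReducible G gatex
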